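{- For every integer $n \geq 1$, let $\ell$ be the positive integer with $\ell^2\leq n<(\ell+1)^2$. Then \[ \sum_{\pi \in \mathcal{D}_2(n)} (-1)^{\# (\pi)-s_2(\pi)}= \begin{cases} (-1)^{\ell-1}+(-1)^{j} & \text{if } n= \frac{j(3j\pm 1)}{2} \text{ for some positive integer } j, \\ (-1)^{\ell - 1} & \text{if } n \text{ is not of the form } \frac{j(3j\pm 1)}{2} \text{ with } j \text{ a positive integer}. \end{cases} \]
   Context: $\mathcal{D}_2(n)$ denotes the set of partitions of $n$ into distinct parts having at least two parts; for such $\pi$, $\#(\pi)$ is the number of parts and $s_2(\pi)$ is the second smallest part. -}

module Defs where

open import Data.Nat as ℕ using (ℕ; zero; suc; _<_; _≤_)
open import Data.Integer as ℤ using (ℤ; +_; -[1+_])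
open import Data.List using (List; []; _∷_; length; foldr; map)
open import Data.Nat.ListAction using (sum)
open import Data.List.Relation.Unary.All using (All)
open import Data.List.Relation.Unary.Linked using (Linked)
open import Data.Product using (_×_)
open import Relation.Binary.PropositionalEquality using (_≡_)

IsDistinctPartition : ℕ → List ℕ → Set
IsDistinctPartition n π = Linked _<_ π × All (0 <_) π × sum π ≡ n

D₂ : ℕ → List ℕ → Set
D₂ n π = IsDistinctPartition n π × 2 ≤ length π

numParts : List ℕ → ℕ
numParts = length

-- s₂(π): second smallest part (π is stored in increasing order);
-- default 0 for lists with fewer than two parts (never used on 𝒟₂(n)).
s₂ : List ℕ → ℕ
s₂ (_ ∷ y ∷ _) = y
s₂ _ = 0

negOnePowℕ : ℕ → ℤ
negOnePowℕ zero = + 1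
negOnePowℕ (suc zero) = -[1+ 0 ]
negOnePowℕ (suc (suc k)) = negOnePowℕ k

negOnePow : ℤ → ℤ
negOnePow k = negOnePowℕ ℤ.∣ k ∣

summand : List ℕ → ℤ
summand π = negOnePow (+ numParts π ℤ.- + s₂ π)

sumℤ : List ℤ → ℤ
sumℤ = foldr ℤ._+_ (+ 0)

-- n = j(3j+1)/2 or n = j(3j-1)/2
IsPentagonalFor : ℕ → ℕ → Set
IsPentagonalFor n j = (2 ℕ.* n ≡ j ℕ.* (3 ℕ.* j ℕ.+ 1)) Data.Sum.⊎ (2 ℕ.* n ℕ.+ j ≡ 3 ℕ.* j ℕ.* j)
  where import Data.Sum

{-# OPTIONS --safe #-}

-- Write P_n = ∏_{k≤n} (1 - q^k) and let U be the generating function of the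
-- signed sum.  Splitting off the two smallest parts gives
--   (1 - q) U = (1 - q) P_∞ - ∑_s (-1)^s q^s P_∞/P_s.
-- The first term is evaluated by Euler's pentagonal number theorem; the second
-- series times ∏ (1 + q^k) is P_∞, so by Gauss it equals ∑_{j∈ℤ} (-1)^j q^{j²},
-- whose partial sums up to n are (-1)^ℓ.  Both theorems are cases (a = 0 and a = 1)
-- of one finite telescoping identity in the style of Shanks, and limits are replaced
-- by congruences modulo q^(n+1).
module Submission where

open import Defs
open import Algebra.Bundles using (CommutativeRing)
import Algebra.Properties.CommutativeSemiring.Exp as Exponentiation
import Algebra.Solver.Ring as RingSolver
open import Algebra.Solver.Ring.AlmostCommutativeRing using (fromCommutativeRing; _-Raw-AlmostCommutative⟶_)
open import Data.Integer as ℤ using (ℤ; 0ℤ; 1ℤ; ∣_∣) renaming (_+_ to _+ℤ_; _*_ to _*ℤ_; -_ to -ℤ_; _-_ to _-ℤ_)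
import Data.Integer.Properties as ℤₚ
open import Data.Integer.Tactic.RingSolver using (solve-∀)
open import Data.List using (List; []; _∷_; _++_; map; length; filter)
open import Data.List.Properties using (∷-injectiveʳ; map-∘; map-++)
open import Data.List.Membership.Propositional using (_∈_)
open import Data.List.Membership.Propositional.Properties using (∈-++⁺ˡ; ∈-++⁺ʳ; ∈-++⁻; ∈-map⁺; ∈-map⁻; ∈-filter⁺; ∈-filter⁻)
open import Data.List.Membership.Propositional.Properties.WithK using (unique∧set⇒bag)
open import Data.List.Relation.Binary.BagAndSetEquality using (∼bag⇒↭)
open import Data.List.Relation.Binary.Permutation.Propositional using (_↭_; ↭⇒↭ₛ)
import Data.List.Relation.Binary.Permutation.Propositional.Properties as Perm
open import Data.List.Relation.Binary.Permutation.Setoid.Properties using (foldr-commMonoid)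
open import Data.List.Relation.Unary.All as All using (All; []; _∷_)
import Data.List.Relation.Unary.AllPairs as AllPairs
open import Data.List.Relation.Unary.Any using (here)
open import Data.List.Relation.Unary.Linked as Linked using (Linked; []; [-]; _∷_)
open import Data.List.Relation.Unary.Linked.Properties using (Linked⇒All; Linked⇒AllPairs)
open import Data.List.Relation.Unary.Unique.Propositional using (Unique)
import Data.List.Relation.Unary.Unique.Propositional.Properties as Unique
open import Data.Maybe using (Maybe; just; nothing)
open import Data.Nat using (ℕ; zero; suc; _≤_; _<_; _^_; _+_; _∸_; _*_; s≤s; z≤n; _≤?_)
open import Data.Nat.ListAction using (sum)
import Data.Nat.Properties as ℕₚ
import Data.Nat.Tactic.RingSolver as ℕ-RingSolver
open import Data.Product using (_×_; ∃-syntax; _,_)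
open import Data.Sum using (inj₁; inj₂; _⊎_)
open import Function using (_∘_)
open import Function.Bundles using (_⇔_; mk⇔; Equivalence)
open import Level using (0ℓ)
import Relation.Binary.Reasoning.Setoid as SetoidReasoning
open import Relation.Binary.PropositionalEquality using (_≡_; _≢_; _≗_; refl; sym; trans; cong; cong₂; subst; setoid; module ≡-Reasoning)
open import Relation.Nullary using (¬_; yes; no; contradiction)

-- The factor `1 - q` comes from the smallest part: below a second smallest part `s` it runs over
-- `1, …, s-1`, which contributes the geometric sum `(q - q^s)/(1 - q)`. The product `∏ (1 + q^k)`
-- comes from a functional equation: after `q^s` is replaced by `q^(ms)` in the second series,
-- passing from `m` to `m+1` multiplies the series by `1 + q^m`, and as `m` grows only the term
-- `s = 0`, which is `P`, survives. No infinite object is needed, because a single `n` bounds the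
-- parts, the number of terms and the precision. The identities are kept exact for finite cutoffs,
-- and every boundary term turns out to carry `q^(n+1)`. The algebra takes place in an arbitrary
-- commutative ring with a chosen element `q`. Coefficients enter only afterwards, to divide by
-- `1 - q` through partial sums and to read off the answer.

triangular : ℕ → ℕ
triangular zero    = 0
triangular (suc n) = suc n + triangular n

-- j(3j-1)/2; the other pentagonal number of index j is pentagonal j + j.
pentagonal : ℕ → ℕ
pentagonal zero    = 0
pentagonal (suc n) = suc n * suc n + triangular n

-- Finite q-products and the telescoping Shanks sums.

module QSeries
  (R : CommutativeRing 0ℓ 0ℓ)
  (integers : CommutativeRing.rawRing ℤₚ.+-*-commutativeRing -Raw-AlmostCommutative⟶ fromCommutativeRing R)
  (q : CommutativeRing.Carrier R)
  where

  open CommutativeRing R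
    using (Carrier; _≈_; 0#; 1#; -_; commutativeSemiring; +-cong; *-cong; +-congˡ; +-congʳ; *-congˡ; *-congʳ; -‿cong;
      +-identityˡ; +-identityʳ; *-identityʳ; *-assoc; *-comm; zeroˡ; zeroʳ; -‿inverseʳ)
    renaming (_+_ to infixl 6 _⊕_; _*_ to infixl 7 _⊗_; refl to ≈-refl; sym to ≈-sym; trans to ≈-trans; reflexive to ≈-reflexive)
  open Exponentiation commutativeSemiring using (^-congˡ; ^-homo-*; ^-assocʳ; ^-distrib-*) renaming (_^_ to _↑_)
  open SetoidReasoning (CommutativeRing.setoid R)

  infixl 6 _⊖_

  _⊖_ : Carrier → Carrier → Carrier
  x ⊖ y = x ⊕ (- y)

  private
    coefficient-equality : ∀ a b → Maybe (_-Raw-AlmostCommutative⟶_.⟦_⟧ integers a ≈ _-Raw-AlmostCommutative⟶_.⟦_⟧ integers b)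
    coefficient-equality a b with a ℤₚ.≟ b
    ... | yes refl = just ≈-refl
    ... | no _     = nothing

  open RingSolver _ (fromCommutativeRing R) integers coefficient-equality
    using (solve; _:=_; _:+_; _:*_; :-_; _:-_; _:^_; con; Polynomial)

  private
    -- The solver interprets con 1ℤ as the image of the integer 1, which is
    -- only propositionally 1#; a zeroth power is 1# by computation.
    :1 : ∀ {n} → Polynomial n
    :1 = con 0ℤ :^ 0

  ε : ℕ → Carrier
  ε n = (- 1#) ↑ n

  -- C d s = ∏ (1 - q^k) over s < k ≤ s + d
  C : ℕ → ℕ → Carrier
  C zero    s = 1#
  C (suc d) s = (1# ⊖ q ↑ suc s) ⊗ C d (suc s)

  P : ℕ → Carrier
  P n = C n 0

  C-top : ∀ d s → C (suc d) s ≈ C d s ⊗ (1# ⊖ q ↑ suc (s + d))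
  C-top zero s rewrite ℕₚ.+-identityʳ s =
    solve 1 (λ x → x :* :1 := :1 :* x) ≈-refl (1# ⊖ q ↑ suc s)
  C-top (suc d) s rewrite ℕₚ.+-suc s d = begin
    y ⊗ C (suc d) (suc s)                              ≈⟨ *-congˡ (C-top d (suc s)) ⟩
    y ⊗ (C d (suc s) ⊗ (1# ⊖ q ↑ suc (suc s + d)))     ≈⟨ solve 3 (λ a b c → a :* (b :* c) := a :* b :* c) ≈-refl y (C d (suc s)) _ ⟩
    C (suc d) s ⊗ (1# ⊖ q ↑ suc (suc s + d))           ∎
    where y = 1# ⊖ q ↑ suc s

  -- T a n, for n = s + d and s = 0, is the Horner form of the Shanks sum
  -- ∑_i (-1)^i q^(i(n+1)) ∏_{r<i} (a + q^r) ∏_{i<k≤n} (1 - q^k).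
  H : Carrier → ℕ → ℕ → Carrier
  H a zero    s = 1#
  H a (suc d) s = C (suc d) s ⊖ q ↑ suc (suc s + d) ⊗ (a ⊕ q ↑ s) ⊗ H a d (suc s)

  -- The error left when the telescoping recursion is unrolled to its last term.
  E : Carrier → ℕ → ℕ → Carrier
  E a zero    s = - (q ↑ suc s ⊗ (a ⊕ q ↑ s) ⊗ (1# ⊕ q ↑ suc s))
  E a (suc d) s = - (q ↑ suc (suc s + d) ⊗ (a ⊕ q ↑ s) ⊗ E a d (suc s))

  -- The shift `s` makes the induction possible, since one Horner step replaces `s` by `s + 1`. The
  -- factor `q ↑ s` absorbs the change of the outer power from `q^(n+1)` to `q^(n+2)`, and the
  -- correction `(1 - q^s) C d s` reproduces itself once the leading products are collected. At
  -- `s = 0` the correction vanishes, leaving a first-order recurrence in `n` for `T a n`.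
  shanks : ∀ a d s →
    q ↑ s ⊗ H a (suc d) s ⊖ (1# ⊕ a ⊗ q ↑ suc (s + d)) ⊗ H a d s ≈ E a d s ⊖ (1# ⊖ q ↑ s) ⊗ C d s
  shanks a zero s rewrite ℕₚ.+-identityʳ s =
    solve 3 (λ a q u → let x = q :* u in
        u :* ((:1 :- x) :* :1 :- q :* x :* (a :+ u) :* :1) :- (:1 :+ a :* x) :* :1
          := (:- (x :* (a :+ u) :* (:1 :+ x))) :- (:1 :- u) :* :1)
      ≈-refl a q (q ↑ s)
  shanks a (suc d) s rewrite ℕₚ.+-suc s d = begin
    u ⊗ (C (suc (suc d)) s ⊖ q ⊗ x ⊗ (a ⊕ u) ⊗ H₁) ⊖ (1# ⊕ a ⊗ x) ⊗ (y ⊗ c ⊖ x ⊗ (a ⊕ u) ⊗ H₀)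
      ≈⟨ +-congʳ (*-congˡ (+-congʳ (≈-trans (C-top (suc d) s) (*-congˡ (+-congˡ (-‿cong (≈-reflexive (cong (λ i → q ↑ suc i) (ℕₚ.+-suc s d))))))))) ⟩
    u ⊗ (y ⊗ c ⊗ (1# ⊖ x) ⊖ q ⊗ x ⊗ (a ⊕ u) ⊗ H₁) ⊖ (1# ⊕ a ⊗ x) ⊗ (y ⊗ c ⊖ x ⊗ (a ⊕ u) ⊗ H₀)
      ≈⟨ solve 7 (λ a q u x c H₁ H₀ → let y = :1 :- q :* u in
            u :* (y :* c :* (:1 :- x) :- q :* x :* (a :+ u) :* H₁) :- (:1 :+ a :* x) :* (y :* c :- x :* (a :+ u) :* H₀)
              := y :* c :* (u :- u :* x :- :1 :- a :* x) :- x :* (a :+ u) :* (q :* u :* H₁ :- (:1 :+ a :* x) :* H₀))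
          ≈-refl a q u x c H₁ H₀ ⟩
    y ⊗ c ⊗ (u ⊖ u ⊗ x ⊖ 1# ⊖ a ⊗ x) ⊖ x ⊗ (a ⊕ u) ⊗ (q ⊗ u ⊗ H₁ ⊖ (1# ⊕ a ⊗ x) ⊗ H₀)
      ≈⟨ +-congˡ (-‿cong (*-congˡ (shanks a d (suc s)))) ⟩
    y ⊗ c ⊗ (u ⊖ u ⊗ x ⊖ 1# ⊖ a ⊗ x) ⊖ x ⊗ (a ⊕ u) ⊗ (E a d (suc s) ⊖ y ⊗ c)
      ≈⟨ solve 6 (λ a q u x c e → let y = :1 :- q :* u in
            y :* c :* (u :- u :* x :- :1 :- a :* x) :- x :* (a :+ u) :* (e :- y :* c)
              := (:- (x :* (a :+ u) :* e)) :- (:1 :- u) :* (y :* c))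
          ≈-refl a q u x c (E a d (suc s)) ⟩
    E a (suc d) s ⊖ (1# ⊖ u) ⊗ (y ⊗ c) ∎
    where
    u = q ↑ s
    x = q ↑ suc (suc s + d)
    y = 1# ⊖ q ↑ suc s
    c = C d (suc s)
    H₁ = H a (suc d) (suc s)
    H₀ = H a d (suc s)

  Π+ : Carrier → ℕ → ℕ → Carrier
  Π+ a zero    s = a ⊕ q ↑ s
  Π+ a (suc d) s = (a ⊕ q ↑ s) ⊗ Π+ a d (suc s)

  Π+-top : ∀ a d s → Π+ a (suc d) s ≈ Π+ a d s ⊗ (a ⊕ q ↑ suc (s + d))
  Π+-top a zero    s rewrite ℕₚ.+-identityʳ s = ≈-refl
  Π+-top a (suc d) s rewrite ℕₚ.+-suc s d = begin
    y ⊗ Π+ a (suc d) (suc s)                             ≈⟨ *-congˡ (Π+-top a d (suc s)) ⟩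
    y ⊗ (Π+ a d (suc s) ⊗ (a ⊕ q ↑ suc (suc s + d)))     ≈⟨ solve 3 (λ a b c → a :* (b :* c) := a :* b :* c) ≈-refl y (Π+ a d (suc s)) _ ⟩
    Π+ a (suc d) s ⊗ (a ⊕ q ↑ suc (suc s + d))           ∎
    where y = a ⊕ q ↑ s

  E-closed : ∀ a d s → let x = q ↑ suc (s + d) in E a d s ≈ (- x) ↑ suc d ⊗ (1# ⊕ x) ⊗ Π+ a d s
  E-closed a zero s rewrite ℕₚ.+-identityʳ s =
    solve 3 (λ a u x → :- (x :* (a :+ u) :* (:1 :+ x)) := (:- x) :* :1 :* (:1 :+ x) :* (a :+ u)) ≈-refl a (q ↑ s) (q ↑ suc s)
  E-closed a (suc d) s rewrite ℕₚ.+-suc s d = begin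
    - (x ⊗ y ⊗ E a d (suc s))                                       ≈⟨ -‿cong (*-congˡ (E-closed a d (suc s))) ⟩
    - (x ⊗ y ⊗ ((- x) ↑ suc d ⊗ (1# ⊕ x) ⊗ Π+ a d (suc s)))         ≈⟨ solve 4 (λ x y z p → :- (x :* y :* (z :* (:1 :+ x) :* p)) := (:- x) :* z :* (:1 :+ x) :* (y :* p)) ≈-refl x y ((- x) ↑ suc d) (Π+ a d (suc s)) ⟩
    (- x) ↑ suc (suc d) ⊗ (1# ⊕ x) ⊗ (y ⊗ Π+ a d (suc s))           ∎
    where
    x = q ↑ suc (suc s + d)
    y = a ⊕ q ↑ s

  T : Carrier → ℕ → Carrier
  T a n = H a n 0

  T-suc : ∀ a n → let x = q ↑ suc n in
    T a (suc n) ≈ (1# ⊕ a ⊗ x) ⊗ T a n ⊕ (- x) ↑ suc n ⊗ (1# ⊕ x) ⊗ Π+ a n 0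
  T-suc a n = begin
    T a (suc n)
      ≈⟨ solve 2 (λ t z → t := z :+ (:1 :* t :- z)) ≈-refl (T a (suc n)) ((1# ⊕ a ⊗ q ↑ suc n) ⊗ T a n) ⟩
    (1# ⊕ a ⊗ q ↑ suc n) ⊗ T a n ⊕ (1# ⊗ T a (suc n) ⊖ (1# ⊕ a ⊗ q ↑ suc n) ⊗ T a n)
      ≈⟨ +-congˡ (≈-trans (shanks a n 0) (+-congʳ (E-closed a n 0))) ⟩
    (1# ⊕ a ⊗ q ↑ suc n) ⊗ T a n ⊕ (e ⊖ (1# ⊖ 1#) ⊗ P n)
      ≈⟨ solve 3 (λ t e p → t :+ (e :- (:1 :- :1) :* p) := t :+ e) ≈-refl ((1# ⊕ a ⊗ q ↑ suc n) ⊗ T a n) e (P n) ⟩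
    (1# ⊕ a ⊗ q ↑ suc n) ⊗ T a n ⊕ e ∎
    where e = (- (q ↑ suc n)) ↑ suc n ⊗ (1# ⊕ q ↑ suc n) ⊗ Π+ a n 0

  infix 4 _≈_mod-q^_
  -- An explicit quotient, rather than agreement of coefficients, lets the congruence make sense in
  -- an abstract ring.
  record _≈_mod-q^_ (f g : Carrier) (k : ℕ) : Set where
    constructor _,_
    field
      quotient : Carrier
      equality : f ≈ g ⊕ q ↑ k ⊗ quotient

  -- Every term of the Shanks sum except `i = 0` carries `q^(n+1)`. The parameter `a` occurs only in
  -- those terms, so both specialisations approximate the same product.
  T≈P : ∀ a n → T a n ≈ P n mod-q^ suc n
  T≈P a zero    = (1# ⊖ 1#) , solve 1 (λ x → :1 := :1 :+ x :* (:1 :- :1)) ≈-refl (q ↑ 1)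
  T≈P a (suc n) = - ((a ⊕ 1#) ⊗ H a n 1) ,
    solve 4 (λ p x y h → p :- x :* y :* h := p :+ x :* (:- (y :* h))) ≈-refl (P (suc n)) (q ↑ suc (suc n)) (a ⊕ 1#) (H a n 1)

  -- The specialisations `a = 0` (Euler) and `a = 1` (Gauss).

  neg-↑ : ∀ x k → (- x) ↑ k ≈ ε k ⊗ x ↑ k
  neg-↑ x k = ≈-trans
    (^-congˡ k (solve 1 (λ x → :- x := (:- :1) :* x) ≈-refl x))
    (^-distrib-* (- 1#) x k)

  euler : ℕ → Carrier
  euler zero    = 1#
  euler (suc n) = euler n ⊕ ε (suc n) ⊗ (q ↑ pentagonal (suc n) ⊗ (1# ⊕ q ↑ suc n))

  Π+0 : ∀ n → Π+ 0# n 0 ≈ q ↑ triangular n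
  Π+0 zero    = +-identityˡ 1#
  Π+0 (suc n) = begin
    Π+ 0# (suc n) 0                       ≈⟨ Π+-top 0# n 0 ⟩
    Π+ 0# n 0 ⊗ (0# ⊕ q ↑ suc n)          ≈⟨ *-cong (Π+0 n) (+-identityˡ _) ⟩
    q ↑ triangular n ⊗ q ↑ suc n          ≈⟨ *-comm _ _ ⟩
    q ↑ suc n ⊗ q ↑ triangular n          ≈⟨ ^-homo-* q (suc n) (triangular n) ⟨
    q ↑ triangular (suc n)                ∎

  -- At `a = 0` the multiplier in `T-suc` is 1, so `T` simply accumulates its increments. With
  -- `j = n + 1` the increment is `(-1)^j q^(j²) q^(j(j-1)/2) (1 + q^j)`, which is why `pentagonal`
  -- is defined as a square plus a triangular number.
  T0≈euler : ∀ n → T 0# n ≈ euler n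
  T0≈euler zero    = ≈-refl
  T0≈euler (suc n) = begin
    T 0# (suc n)                                                            ≈⟨ T-suc 0# n ⟩
    (1# ⊕ 0# ⊗ x) ⊗ T 0# n ⊕ (- x) ↑ suc n ⊗ (1# ⊕ x) ⊗ Π+ 0# n 0          ≈⟨ +-cong (*-cong (≈-trans (+-congˡ (zeroˡ x)) (+-identityʳ 1#)) (T0≈euler n)) (*-cong (*-congʳ (≈-trans (neg-↑ x (suc n)) (*-congˡ (^-assocʳ q (suc n) (suc n))))) (Π+0 n)) ⟩
    1# ⊗ euler n ⊕ ε (suc n) ⊗ y ⊗ (1# ⊕ x) ⊗ z                             ≈⟨ solve 5 (λ t e y x z → :1 :* t :+ e :* y :* (:1 :+ x) :* z := t :+ e :* (y :* z :* (:1 :+ x))) ≈-refl (euler n) (ε (suc n)) y x z ⟩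
    euler n ⊕ ε (suc n) ⊗ (y ⊗ z ⊗ (1# ⊕ x))                                ≈⟨ +-congˡ (*-congˡ (*-congʳ (≈-sym (^-homo-* q (suc n * suc n) (triangular n))))) ⟩
    euler (suc n)                                                           ∎
    where
    x = q ↑ suc n
    y = q ↑ (suc n * suc n)
    z = q ↑ triangular n

  -- Gauss's theta series cut off at `|j| ≤ n`, with the terms of `j` and `-j` merged.
  θ : ℕ → Carrier
  θ zero    = 1#
  θ (suc n) = θ n ⊕ (1# ⊕ 1#) ⊗ (ε (suc n) ⊗ q ↑ (suc n * suc n))

  M : ℕ → Carrier
  M zero    = 1#
  M (suc n) = M n ⊗ (1# ⊕ q ↑ suc n)

  -- The leading 2 is the factor `1 + q^0`; it becomes the doubled coefficient in `θ`.
  Π+1 : ∀ n → Π+ 1# n 0 ≈ (1# ⊕ 1#) ⊗ M n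
  Π+1 zero    = solve 0 (:1 :+ :1 := (:1 :+ :1) :* :1) ≈-refl
  Π+1 (suc n) = ≈-trans (Π+-top 1# n 0) (≈-trans (*-congʳ (Π+1 n)) (*-assoc _ _ _))

  -- At `a = 1` the multiplier in `T-suc` is the factor by which `M` grows, and the increment
  -- contains `M (suc n)` too. Up to this common factor the recurrence only adds the next theta
  -- term.
  T1≈Mθ : ∀ n → T 1# n ≈ M n ⊗ θ n
  T1≈Mθ zero    = solve 0 (:1 := :1 :* :1) ≈-refl
  T1≈Mθ (suc n) = begin
    T 1# (suc n)                                                            ≈⟨ T-suc 1# n ⟩
    (1# ⊕ 1# ⊗ x) ⊗ T 1# n ⊕ (- x) ↑ suc n ⊗ (1# ⊕ x) ⊗ Π+ 1# n 0          ≈⟨ +-cong (*-congˡ (T1≈Mθ n)) (*-cong (*-congʳ (≈-trans (neg-↑ x (suc n)) (*-congˡ (^-assocʳ q (suc n) (suc n))))) (Π+1 n)) ⟩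
    (1# ⊕ 1# ⊗ x) ⊗ (M n ⊗ θ n) ⊕ ε (suc n) ⊗ y ⊗ (1# ⊕ x) ⊗ ((1# ⊕ 1#) ⊗ M n)
      ≈⟨ solve 5 (λ m t e y x → (:1 :+ :1 :* x) :* (m :* t) :+ e :* y :* (:1 :+ x) :* ((:1 :+ :1) :* m) := m :* (:1 :+ x) :* (t :+ (:1 :+ :1) :* (e :* y))) ≈-refl (M n) (θ n) (ε (suc n)) y x ⟩
    M (suc n) ⊗ θ (suc n)                                                   ∎
    where
    x = q ↑ suc n
    y = q ↑ (suc n * suc n)

  -- The second series and its functional equation.

  -- Q m n = ∑_{s≤n} (-1)^s q^(ms) ∏_{s<k≤n} (1 - q^k)
  Q : ℕ → ℕ → Carrier
  Q m zero    = 1#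
  Q m (suc n) = (1# ⊖ q ↑ suc n) ⊗ Q m n ⊕ ε (suc n) ⊗ (q ↑ m) ↑ suc n

  -- Replacing `m` by `m + 1` multiplies term `s` by `q^s = 1 - (1 - q^s)`. The factor `1 - q^s`
  -- extends the product of term `s` down to that of term `s - 1`, so the difference is `q^m` times
  -- the same sum shifted by one. The shift misses the last term, hence the boundary term.
  Q-suc : ∀ m n → Q (suc m) n ≈ (1# ⊕ q ↑ m) ⊗ Q m n ⊖ ε n ⊗ (q ↑ m) ↑ suc n
  Q-suc m zero    = solve 1 (λ p → :1 := (:1 :+ p) :* :1 :- :1 :* (p :* :1)) ≈-refl (q ↑ m)
  Q-suc m (suc n) = begin
    (1# ⊖ x) ⊗ Q (suc m) n ⊕ - 1# ⊗ e ⊗ (q ↑ suc m) ↑ suc n            ≈⟨ +-cong (*-congˡ (Q-suc m n)) (*-congˡ (^-distrib-* q (q ↑ m) (suc n))) ⟩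
    (1# ⊖ x) ⊗ ((1# ⊕ p) ⊗ Q m n ⊖ e ⊗ y) ⊕ - 1# ⊗ e ⊗ (x ⊗ y)         ≈⟨ solve 5 (λ x p b e y → (:1 :- x) :* ((:1 :+ p) :* b :- e :* y) :+ (:- :1) :* e :* (x :* y) := (:1 :+ p) :* ((:1 :- x) :* b :+ (:- :1) :* e :* y) :- (:- :1) :* e :* (p :* y)) ≈-refl x p (Q m n) e y ⟩
    (1# ⊕ p) ⊗ Q m (suc n) ⊖ ε (suc n) ⊗ (p ⊗ y)                       ∎
    where
    x = q ↑ suc n
    p = q ↑ m
    e = ε n
    y = p ↑ suc n

  -- Iterates `Q-suc` from `m = 1`. The boundary terms are powers `(q^m)^(n+1)` with `m ≥ 1`, hence
  -- multiples of `q^(n+1)`.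
  M*Q1≈Q : ∀ m n → M m ⊗ Q 1 n ≈ Q (suc m) n mod-q^ suc n
  M*Q1≈Q zero n = (1# ⊖ 1#) , solve 2 (λ b x → :1 :* b := b :+ x :* (:1 :- :1)) ≈-refl (Q 1 n) (q ↑ suc n)
  M*Q1≈Q (suc m) n with M*Q1≈Q m n
  ... | r , eq = (1# ⊕ p) ⊗ r ⊕ ε n ⊗ y , (begin
    M m ⊗ (1# ⊕ p) ⊗ Q 1 n                                       ≈⟨ solve 3 (λ m p b → m :* (:1 :+ p) :* b := (:1 :+ p) :* (m :* b)) ≈-refl (M m) p (Q 1 n) ⟩
    (1# ⊕ p) ⊗ (M m ⊗ Q 1 n)                                     ≈⟨ *-congˡ eq ⟩
    (1# ⊕ p) ⊗ (Q (suc m) n ⊕ x ⊗ r)                             ≈⟨ solve 6 (λ p b x r e y → (:1 :+ p) :* (b :+ x :* r) := ((:1 :+ p) :* b :- e :* (x :* y)) :+ x :* ((:1 :+ p) :* r :+ e :* y)) ≈-refl p (Q (suc m) n) x r (ε n) y ⟩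
    ((1# ⊕ p) ⊗ Q (suc m) n ⊖ ε n ⊗ (x ⊗ y)) ⊕ x ⊗ r′            ≈⟨ +-congʳ (+-congˡ (-‿cong (*-congˡ (≈-sym (^-distrib-* q (q ↑ m) (suc n)))))) ⟩
    ((1# ⊕ p) ⊗ Q (suc m) n ⊖ ε n ⊗ p ↑ suc n) ⊕ x ⊗ r′          ≈⟨ +-congʳ (≈-sym (Q-suc (suc m) n)) ⟩
    Q (suc (suc m)) n ⊕ x ⊗ r′                                   ∎)
    where
    p = q ↑ suc m
    x = q ↑ suc n
    y = (q ↑ m) ↑ suc n
    r′ = (1# ⊕ p) ⊗ r ⊕ ε n ⊗ y

  -- Every term with `s ≥ 1` contains `q^m`; the term `s = 0` is `P n`.
  Q≈P : ∀ m n → Q m n ≈ P n mod-q^ m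
  Q≈P m zero = (1# ⊖ 1#) , solve 1 (λ x → :1 := :1 :+ x :* (:1 :- :1)) ≈-refl (q ↑ m)
  Q≈P m (suc n) with Q≈P m n
  ... | r , eq = y ⊗ r ⊕ ε (suc n) ⊗ p ↑ n , (begin
    y ⊗ Q m n ⊕ ε (suc n) ⊗ (p ⊗ p ↑ n)                      ≈⟨ +-congʳ (*-congˡ eq) ⟩
    y ⊗ (P n ⊕ p ⊗ r) ⊕ ε (suc n) ⊗ (p ⊗ p ↑ n)              ≈⟨ solve 6 (λ y P p r e z → y :* (P :+ p :* r) :+ e :* (p :* z) := P :* y :+ p :* (y :* r :+ e :* z)) ≈-refl y (P n) p r (ε (suc n)) (p ↑ n) ⟩
    P n ⊗ y ⊕ p ⊗ (y ⊗ r ⊕ ε (suc n) ⊗ p ↑ n)                ≈⟨ +-congʳ (≈-sym (C-top n 0)) ⟩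
    P (suc n) ⊕ p ⊗ (y ⊗ r ⊕ ε (suc n) ⊗ p ↑ n)              ∎)
    where
    p = q ↑ m
    y = 1# ⊖ q ↑ suc n

  mod-sym : ∀ {f g k} → f ≈ g mod-q^ k → g ≈ f mod-q^ k
  mod-sym {f} {g} {k} (r , eq) = - r , (begin
    g                               ≈⟨ solve 3 (λ g x r → g := g :+ x :* r :+ x :* (:- r)) ≈-refl g (q ↑ k) r ⟩
    g ⊕ q ↑ k ⊗ r ⊕ q ↑ k ⊗ - r     ≈⟨ +-congʳ (≈-sym eq) ⟩
    f ⊕ q ↑ k ⊗ - r                 ∎)

  mod-trans : ∀ {f g h k} → f ≈ g mod-q^ k → g ≈ h mod-q^ k → f ≈ h mod-q^ k
  mod-trans {f} {g} {h} {k} (r , eq) (r′ , eq′) = r′ ⊕ r , (begin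
    f                                   ≈⟨ eq ⟩
    g ⊕ q ↑ k ⊗ r                       ≈⟨ +-congʳ eq′ ⟩
    h ⊕ q ↑ k ⊗ r′ ⊕ q ↑ k ⊗ r          ≈⟨ solve 4 (λ h x a b → h :+ x :* a :+ x :* b := h :+ x :* (a :+ b)) ≈-refl h (q ↑ k) r′ r ⟩
    h ⊕ q ↑ k ⊗ (r′ ⊕ r)                ∎)

  ≈⇒mod : ∀ {f g} k → f ≈ g → f ≈ g mod-q^ k
  ≈⇒mod {f} {g} k eq = (1# ⊖ 1#) , ≈-trans eq (solve 2 (λ g x → g := g :+ x :* (:1 :- :1)) ≈-refl g (q ↑ k))

  -- Cancellation without constructing an inverse: since `f = m f - q u f`, a congruence between `f`
  -- and `g` modulo `q^k` improves to one modulo `q^(k+1)`, because the unknown error is multiplied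
  -- by `q`.
  unit-cancel : ∀ {m f g} u k → m ≈ 1# ⊕ q ⊗ u → m ⊗ f ≈ m ⊗ g mod-q^ k → f ≈ g mod-q^ k
  unit-cancel {m} {f} {g} u zero    _    _        =
    f ⊖ g , solve 2 (λ f g → f := g :+ :1 :* (f :- g)) ≈-refl f g
  unit-cancel {m} {f} {g} u (suc k) unit (r , eq)
    with unit-cancel u k unit (q ⊗ r , ≈-trans eq (+-congˡ (solve 3 (λ q z r → q :* z :* r := z :* (q :* r)) ≈-refl q (q ↑ k) r)))
  ... | r′ , eq′ = r ⊖ u ⊗ r′ , (begin
    f                                                               ≈⟨ solve 4 (λ q u f g → f := (:1 :+ q :* u) :* f :- q :* u :* f) ≈-refl q u f g ⟩
    (1# ⊕ q ⊗ u) ⊗ f ⊖ q ⊗ u ⊗ f                                    ≈⟨ +-cong (≈-trans (*-congʳ (≈-sym unit)) (≈-trans eq (+-congʳ (*-congʳ unit)))) (-‿cong (*-congˡ eq′)) ⟩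
    (1# ⊕ q ⊗ u) ⊗ g ⊕ q ↑ suc k ⊗ r ⊖ q ⊗ u ⊗ (g ⊕ q ↑ k ⊗ r′)     ≈⟨ solve 6 (λ q z r u r′ g → (:1 :+ q :* u) :* g :+ q :* z :* r :- q :* u :* (g :+ z :* r′) := g :+ q :* z :* (r :- u :* r′)) ≈-refl q (q ↑ k) r u r′ g ⟩
    g ⊕ q ↑ suc k ⊗ (r ⊖ u ⊗ r′)                                    ∎)

  M-unit : ∀ n → ∃[ g ] M n ≈ 1# ⊕ q ⊗ g
  M-unit zero = (1# ⊖ 1#) , solve 1 (λ q → :1 := :1 :+ q :* (:1 :- :1)) ≈-refl q
  M-unit (suc n) with M-unit n
  ... | g , eq = g ⊗ (1# ⊕ q ↑ suc n) ⊕ q ↑ n ,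
    ≈-trans (*-congʳ eq) (solve 3 (λ q g z → (:1 :+ q :* g) :* (:1 :+ q :* z) := :1 :+ q :* (g :* (:1 :+ q :* z) :+ z)) ≈-refl q g (q ↑ n))

  P≈euler : ∀ n → P n ≈ euler n mod-q^ suc n
  P≈euler n = mod-trans (mod-sym (T≈P 0# n)) (≈⇒mod (suc n) (T0≈euler n))

  Q≈θ : ∀ n → Q 1 n ≈ θ n mod-q^ suc n
  Q≈θ n with M-unit n
  ... | g , unit = unit-cancel g (suc n) unit
    -- Taking `n` factors `1 + q^k` brings `Q≈P` to the precision `q^(n+1)` of the other
    -- congruences. Both ends then contain the unit `M n`.
    (mod-trans (M*Q1≈Q n n) (mod-trans (Q≈P (suc n) n) (mod-trans (mod-sym (T≈P 1# n)) (≈⇒mod (suc n) (T1≈Mθ n)))))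

  -- Generating functions by the two smallest parts.

  -- Generating functions of the partitions into distinct parts from {m+1, …, m+k},
  -- weighted by (-1)^(# - 1 - s₁) in W₁ and by (-1)^(# - s₂) in W₂.
  W₁ : ℕ → ℕ → Carrier
  W₁ zero    m = 0#
  W₁ (suc k) m = W₁ k (suc m) ⊕ ε (suc m) ⊗ (q ↑ suc m ⊗ C k (suc m))

  W₂ : ℕ → ℕ → Carrier
  W₂ zero    m = 0#
  W₂ (suc k) m = W₂ k (suc m) ⊕ q ↑ suc m ⊗ W₁ k (suc m)

  -- The definition recurses on the smallest allowed part, but `Q` grows at the largest, so the
  -- recursion is turned around. The largest allowed part is absent, or lies above a smaller part
  -- and flips the sign, or is the only part.
  W₁-top : ∀ k m → let x = q ↑ suc (m + k) in
    W₁ (suc k) m ≈ (1# ⊖ x) ⊗ W₁ k m ⊕ ε (suc (m + k)) ⊗ x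
  W₁-top zero m rewrite ℕₚ.+-identityʳ m = begin
    0# ⊕ ε (suc m) ⊗ (x ⊗ 1#)        ≈⟨ solve 3 (λ o e x → o :+ e :* (x :* :1) := o :+ e :* x) ≈-refl 0# (ε (suc m)) x ⟩
    0# ⊕ ε (suc m) ⊗ x               ≈⟨ +-congʳ (≈-sym (zeroʳ (1# ⊖ x))) ⟩
    (1# ⊖ x) ⊗ 0# ⊕ ε (suc m) ⊗ x    ∎
    where x = q ↑ suc m
  W₁-top (suc k) m rewrite ℕₚ.+-suc m k = begin
    W₁ (suc k) (suc m) ⊕ e ⊗ (y ⊗ C (suc k) (suc m))                              ≈⟨ +-cong (W₁-top k (suc m)) (*-congˡ (*-congˡ (C-top k (suc m)))) ⟩
    (1# ⊖ x) ⊗ W₁ k (suc m) ⊕ e′ ⊗ x ⊕ e ⊗ (y ⊗ (C k (suc m) ⊗ (1# ⊖ x)))         ≈⟨ solve 6 (λ x w z e y c → (:1 :- x) :* w :+ z :* x :+ e :* (y :* (c :* (:1 :- x))) := (:1 :- x) :* (w :+ e :* (y :* c)) :+ z :* x) ≈-refl x (W₁ k (suc m)) e′ e y (C k (suc m)) ⟩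
    (1# ⊖ x) ⊗ W₁ (suc k) m ⊕ e′ ⊗ x                                              ∎
    where
    x = q ↑ suc (suc m + k)
    y = q ↑ suc m
    e = ε (suc m)
    e′ = ε (suc (suc m + k))

  geometric : ℕ → ℕ → Carrier
  geometric zero    m = 0#
  geometric (suc k) m = q ↑ suc m ⊕ geometric k (suc m)

  geometric-closed : ∀ k m → (1# ⊖ q) ⊗ geometric k m ≈ q ↑ suc m ⊖ q ↑ suc (m + k)
  geometric-closed zero    m rewrite ℕₚ.+-identityʳ m =
    ≈-trans (zeroʳ (1# ⊖ q)) (≈-sym (-‿inverseʳ (q ↑ suc m)))
  geometric-closed (suc k) m rewrite ℕₚ.+-suc m k = begin
    (1# ⊖ q) ⊗ (x ⊕ geometric k (suc m))             ≈⟨ solve 3 (λ q x g → (:1 :- q) :* (x :+ g) := x :- q :* x :+ (:1 :- q) :* g) ≈-refl q x (geometric k (suc m)) ⟩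
    x ⊖ q ⊗ x ⊕ (1# ⊖ q) ⊗ geometric k (suc m)       ≈⟨ +-congˡ (geometric-closed k (suc m)) ⟩
    x ⊖ q ⊗ x ⊕ (q ⊗ x ⊖ y)                          ≈⟨ solve 3 (λ q x y → x :- q :* x :+ (q :* x :- y) := x :- y) ≈-refl q x y ⟩
    x ⊖ y                                            ∎
    where
    x = q ↑ suc m
    y = q ↑ suc (suc m + k)

  -- The extra term counts the partitions in which the new largest part is itself the second
  -- smallest; `geometric` sums over the one part below it.
  W₂-top : ∀ k m → let x = q ↑ suc (m + k) in
    W₂ (suc k) m ≈ (1# ⊖ x) ⊗ W₂ k m ⊕ ε (suc (m + k)) ⊗ (x ⊗ geometric k m)
  W₂-top zero m rewrite ℕₚ.+-identityʳ m = begin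
    0# ⊕ x ⊗ 0#                          ≈⟨ +-congˡ (zeroʳ x) ⟩
    0# ⊕ 0#                              ≈⟨ +-cong (zeroʳ (1# ⊖ x)) (≈-trans (*-congˡ (zeroʳ x)) (zeroʳ _)) ⟨
    (1# ⊖ x) ⊗ 0# ⊕ ε (suc m) ⊗ (x ⊗ 0#) ∎
    where x = q ↑ suc m
  W₂-top (suc k) m rewrite ℕₚ.+-suc m k = begin
    W₂ (suc k) (suc m) ⊕ y ⊗ W₁ (suc k) (suc m)
      ≈⟨ +-cong (W₂-top k (suc m)) (*-congˡ (W₁-top k (suc m))) ⟩
    (1# ⊖ x) ⊗ W₂ k (suc m) ⊕ e ⊗ (x ⊗ g) ⊕ y ⊗ ((1# ⊖ x) ⊗ W₁ k (suc m) ⊕ e ⊗ x)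
      ≈⟨ solve 6 (λ x v w e y g → (:1 :- x) :* v :+ e :* (x :* g) :+ y :* ((:1 :- x) :* w :+ e :* x) := (:1 :- x) :* (v :+ y :* w) :+ e :* (x :* (y :+ g))) ≈-refl x (W₂ k (suc m)) (W₁ k (suc m)) e y g ⟩
    (1# ⊖ x) ⊗ W₂ (suc k) m ⊕ e ⊗ (x ⊗ geometric (suc k) m) ∎
    where
    x = q ↑ suc (suc m + k)
    y = q ↑ suc m
    e = ε (suc (suc m + k))
    g = geometric k (suc m)

  -- With second smallest part `s`, the left side is the sum over `1 ≤ s ≤ n` of
  -- `(-1)^s q^s (q - q^s) P_n/P_s`. Write `q - q^s = (1 - q^s) - (1 - q)`. The first piece shifts
  -- the index and gives `-q Q 1 n` plus the boundary term, and the second gives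
  -- `-(1 - q)(Q 1 n - P n)`.
  W₂≈P-Q : ∀ n → (1# ⊖ q) ⊗ W₂ n 0 ≈ (1# ⊖ q) ⊗ P n ⊖ Q 1 n ⊕ ε n ⊗ q ↑ suc n
  W₂≈P-Q zero = ≈-trans (zeroʳ (1# ⊖ q))
    (≈-trans (≈-sym (-‿inverseʳ 1#))
      (solve 1 (λ q → :1 :- :1 := (:1 :- q) :* :1 :- :1 :+ :1 :* (q :* :1)) ≈-refl q))
  W₂≈P-Q (suc n) = begin
    (1# ⊖ q) ⊗ W₂ (suc n) 0
      ≈⟨ *-congˡ (W₂-top n 0) ⟩
    (1# ⊖ q) ⊗ ((1# ⊖ x) ⊗ W₂ n 0 ⊕ - 1# ⊗ e ⊗ (x ⊗ geometric n 0))
      ≈⟨ solve 5 (λ q x w e g → (:1 :- q) :* ((:1 :- x) :* w :+ (:- :1) :* e :* (x :* g)) := (:1 :- x) :* ((:1 :- q) :* w) :+ (:- :1) :* e :* (x :* ((:1 :- q) :* g))) ≈-refl q x (W₂ n 0) e (geometric n 0) ⟩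
    (1# ⊖ x) ⊗ ((1# ⊖ q) ⊗ W₂ n 0) ⊕ - 1# ⊗ e ⊗ (x ⊗ ((1# ⊖ q) ⊗ geometric n 0))
      ≈⟨ +-cong (*-congˡ (W₂≈P-Q n)) (*-congˡ (*-congˡ (geometric-closed n 0))) ⟩
    (1# ⊖ x) ⊗ ((1# ⊖ q) ⊗ P n ⊖ Q 1 n ⊕ e ⊗ x) ⊕ - 1# ⊗ e ⊗ (x ⊗ (q ⊗ 1# ⊖ x))
      ≈⟨ solve 5 (λ q x p b e → (:1 :- x) :* ((:1 :- q) :* p :- b :+ e :* x) :+ (:- :1) :* e :* (x :* (q :* :1 :- x))
            := (:1 :- q) :* (p :* (:1 :- x)) :- ((:1 :- x) :* b :+ (:- :1) :* e :* x) :+ (:- :1) :* e :* (q :* x)) ≈-refl q x (P n) (Q 1 n) e ⟩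
    (1# ⊖ q) ⊗ (P n ⊗ (1# ⊖ x)) ⊖ ((1# ⊖ x) ⊗ Q 1 n ⊕ ε (suc n) ⊗ x) ⊕ ε (suc n) ⊗ q ↑ suc (suc n)
      ≈⟨ +-congʳ (+-cong (*-congˡ (≈-sym (C-top n 0))) (-‿cong (+-congˡ (*-congˡ (^-congˡ (suc n) (≈-sym (*-identityʳ q))))))) ⟩
    (1# ⊖ q) ⊗ P (suc n) ⊖ Q 1 (suc n) ⊕ ε (suc n) ⊗ q ↑ suc (suc n) ∎
    where
    x = q ↑ suc n
    e = ε n

  mod-combine : ∀ {k p p′ t t′} y e → p ≈ p′ mod-q^ k → t ≈ t′ mod-q^ k →
    y ⊗ p ⊖ t ⊕ e ⊗ q ↑ k ≈ y ⊗ p′ ⊖ t′ mod-q^ k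
  mod-combine {k} {p} {p′} {t} {t′} y e (r , p≈) (s , t≈) = y ⊗ r ⊖ s ⊕ e , (begin
    y ⊗ p ⊖ t ⊕ e ⊗ x                             ≈⟨ +-congʳ (+-cong (*-congˡ p≈) (-‿cong t≈)) ⟩
    y ⊗ (p′ ⊕ x ⊗ r) ⊖ (t′ ⊕ x ⊗ s) ⊕ e ⊗ x       ≈⟨ solve 7 (λ y p x r t s e → y :* (p :+ x :* r) :- (t :+ x :* s) :+ e :* x := y :* p :- t :+ x :* (y :* r :- s :+ e)) ≈-refl y p′ x r t′ s e ⟩
    y ⊗ p′ ⊖ t′ ⊕ x ⊗ (y ⊗ r ⊖ s ⊕ e)             ∎)
    where x = q ↑ k

  W₂≈euler-θ : ∀ n → (1# ⊖ q) ⊗ W₂ n 0 ≈ (1# ⊖ q) ⊗ euler n ⊖ θ n mod-q^ suc n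
  W₂≈euler-θ n = mod-trans (≈⇒mod (suc n) (W₂≈P-Q n)) (mod-combine (1# ⊖ q) (ε n) (P≈euler n) (Q≈θ n))

-- The commutative ring of integer power series.

Series : Set
Series = ℕ → ℤ

infixl 7 _⋆_
-- The Cauchy product through `f = f 0 + X (f ∘ suc)`, so that the ring laws follow by induction on
-- the degree with `f` varying.
_⋆_ : Series → Series → Series
(f ⋆ g) zero    = f 0 *ℤ g 0
(f ⋆ g) (suc n) = f 0 *ℤ g (suc n) +ℤ ((f ∘ suc) ⋆ g) n

constant : ℤ → Series
constant c zero    = c
constant c (suc n) = 0ℤ

⋆-cong : ∀ {f f′ g g′} → f ≗ f′ → g ≗ g′ → f ⋆ g ≗ f′ ⋆ g′
⋆-cong p r zero    = cong₂ _*ℤ_ (p 0) (r 0)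
⋆-cong p r (suc n) = cong₂ _+ℤ_ (cong₂ _*ℤ_ (p 0) (r (suc n))) (⋆-cong (p ∘ suc) r n)

⋆-distribˡ : ∀ f g h → f ⋆ (λ k → g k +ℤ h k) ≗ λ n → (f ⋆ g) n +ℤ (f ⋆ h) n
⋆-distribˡ f g h zero    = ℤₚ.*-distribˡ-+ (f 0) (g 0) (h 0)
⋆-distribˡ f g h (suc n) = trans
  (cong (f 0 *ℤ (g (suc n) +ℤ h (suc n)) +ℤ_) (⋆-distribˡ (f ∘ suc) g h n))
  (rearrange (f 0) (g (suc n)) (h (suc n)) _ _)
  where
  rearrange : ∀ a b c d e → a *ℤ (b +ℤ c) +ℤ (d +ℤ e) ≡ (a *ℤ b +ℤ d) +ℤ (a *ℤ c +ℤ e)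
  rearrange = solve-∀

⋆-distribʳ : ∀ h f g → (λ k → f k +ℤ g k) ⋆ h ≗ λ n → (f ⋆ h) n +ℤ (g ⋆ h) n
⋆-distribʳ h f g zero    = ℤₚ.*-distribʳ-+ (h 0) (f 0) (g 0)
⋆-distribʳ h f g (suc n) = trans
  (cong ((f 0 +ℤ g 0) *ℤ h (suc n) +ℤ_) (⋆-distribʳ h (f ∘ suc) (g ∘ suc) n))
  (rearrange (f 0) (g 0) (h (suc n)) _ _)
  where
  rearrange : ∀ a b c d e → (a +ℤ b) *ℤ c +ℤ (d +ℤ e) ≡ (a *ℤ c +ℤ d) +ℤ (b *ℤ c +ℤ e)
  rearrange = solve-∀

⋆-scaleˡ : ∀ c f g → (λ k → c *ℤ f k) ⋆ g ≗ λ n → c *ℤ (f ⋆ g) n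
⋆-scaleˡ c f g zero    = ℤₚ.*-assoc c (f 0) (g 0)
⋆-scaleˡ c f g (suc n) = trans
  (cong (c *ℤ f 0 *ℤ g (suc n) +ℤ_) (⋆-scaleˡ c (f ∘ suc) g n))
  (rearrange c (f 0) (g (suc n)) _)
  where
  rearrange : ∀ a b c d → a *ℤ b *ℤ c +ℤ a *ℤ d ≡ a *ℤ (b *ℤ c +ℤ d)
  rearrange = solve-∀

⋆-assoc : ∀ f g h → (f ⋆ g) ⋆ h ≗ f ⋆ (g ⋆ h)
⋆-assoc f g h zero    = ℤₚ.*-assoc (f 0) (g 0) (h 0)
⋆-assoc f g h (suc n) = begin
  f 0 *ℤ g 0 *ℤ h (suc n) +ℤ ((λ k → f 0 *ℤ g (suc k) +ℤ ((f ∘ suc) ⋆ g) k) ⋆ h) n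
    ≡⟨ cong (f 0 *ℤ g 0 *ℤ h (suc n) +ℤ_) (⋆-distribʳ h (λ k → f 0 *ℤ g (suc k)) ((f ∘ suc) ⋆ g) n) ⟩
  f 0 *ℤ g 0 *ℤ h (suc n) +ℤ (((λ k → f 0 *ℤ g (suc k)) ⋆ h) n +ℤ (((f ∘ suc) ⋆ g) ⋆ h) n)
    ≡⟨ cong (f 0 *ℤ g 0 *ℤ h (suc n) +ℤ_) (cong₂ _+ℤ_ (⋆-scaleˡ (f 0) (g ∘ suc) h n) (⋆-assoc (f ∘ suc) g h n)) ⟩
  f 0 *ℤ g 0 *ℤ h (suc n) +ℤ (f 0 *ℤ ((g ∘ suc) ⋆ h) n +ℤ ((f ∘ suc) ⋆ (g ⋆ h)) n)
    ≡⟨ rearrange (f 0) (g 0) (h (suc n)) _ _ ⟩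
  f 0 *ℤ (g 0 *ℤ h (suc n) +ℤ ((g ∘ suc) ⋆ h) n) +ℤ ((f ∘ suc) ⋆ (g ⋆ h)) n ∎
  where
  open ≡-Reasoning
  rearrange : ∀ a b c d e → a *ℤ b *ℤ c +ℤ (a *ℤ d +ℤ e) ≡ a *ℤ (b *ℤ c +ℤ d) +ℤ e
  rearrange = solve-∀

-- The mirror image of the defining recursion, peeling the right factor; commutativity rests on it.
⋆-sucʳ : ∀ f g n → (f ⋆ g) (suc n) ≡ f (suc n) *ℤ g 0 +ℤ (f ⋆ (g ∘ suc)) n
⋆-sucʳ f g zero    = ℤₚ.+-comm (f 0 *ℤ g 1) (f 1 *ℤ g 0)
⋆-sucʳ f g (suc n) = trans
  (cong (f 0 *ℤ g (suc (suc n)) +ℤ_) (⋆-sucʳ (f ∘ suc) g n))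
  (rearrange (f 0 *ℤ g (suc (suc n))) (f (suc (suc n)) *ℤ g 0) _)
  where
  rearrange : ∀ a b c → a +ℤ (b +ℤ c) ≡ b +ℤ (a +ℤ c)
  rearrange = solve-∀

⋆-comm : ∀ f g → f ⋆ g ≗ g ⋆ f
⋆-comm f g zero    = ℤₚ.*-comm (f 0) (g 0)
⋆-comm f g (suc n) = trans
  (cong₂ _+ℤ_ (ℤₚ.*-comm (f 0) (g (suc n))) (⋆-comm (f ∘ suc) g n))
  (sym (⋆-sucʳ g f n))

0-⋆ : ∀ f n → ((λ _ → 0ℤ) ⋆ f) n ≡ 0ℤ
0-⋆ f zero    = refl
0-⋆ f (suc n) = trans (ℤₚ.+-identityˡ _) (0-⋆ f n)

constant-⋆ : ∀ c f n → (constant c ⋆ f) n ≡ c *ℤ f n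
constant-⋆ c f zero    = refl
constant-⋆ c f (suc n) = trans (cong (c *ℤ f (suc n) +ℤ_) (0-⋆ f n)) (ℤₚ.+-identityʳ _)

1-⋆ : ∀ f → constant 1ℤ ⋆ f ≗ f
1-⋆ f n = trans (constant-⋆ 1ℤ f n) (ℤₚ.*-identityˡ (f n))

series : CommutativeRing 0ℓ 0ℓ
series = record
  { Carrier = Series
  ; _≈_ = _≗_
  ; _+_ = λ f g n → f n +ℤ g n
  ; _*_ = _⋆_
  ; -_  = λ f n → -ℤ f n
  ; 0#  = λ _ → 0ℤ
  ; 1#  = constant 1ℤ
  ; isCommutativeRing = record
    { isRing = record
      { +-isAbelianGroup = record
        { isGroup = record
          { isMonoid = record
            { isSemigroup = record
              { isMagma = record
                { isEquivalence = record
                  { refl = λ _ → refl ; sym = λ p n → sym (p n) ; trans = λ p r n → trans (p n) (r n) }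
                ; ∙-cong = λ p r n → cong₂ _+ℤ_ (p n) (r n) }
              ; assoc = λ f g h n → ℤₚ.+-assoc (f n) (g n) (h n) }
            ; identity = (λ f n → ℤₚ.+-identityˡ (f n)) , (λ f n → ℤₚ.+-identityʳ (f n)) }
          ; inverse = (λ f n → ℤₚ.+-inverseˡ (f n)) , (λ f n → ℤₚ.+-inverseʳ (f n))
          ; ⁻¹-cong = λ p n → cong -ℤ_ (p n) }
        ; comm = λ f g n → ℤₚ.+-comm (f n) (g n) }
      ; *-cong = ⋆-cong
      ; *-assoc = ⋆-assoc
      ; *-identity = 1-⋆ , (λ f n → trans (⋆-comm f (constant 1ℤ) n) (1-⋆ f n))
      ; distrib = ⋆-distribˡ , ⋆-distribʳ }
    ; *-comm = ⋆-comm } }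

constant-homomorphism : CommutativeRing.rawRing ℤₚ.+-*-commutativeRing -Raw-AlmostCommutative⟶ fromCommutativeRing series
constant-homomorphism = record
  { ⟦_⟧    = constant
  ; +-homo = λ where a b zero → refl
                     a b (suc n) → refl
  ; *-homo = *-homo
  ; -‿homo = λ where a zero → refl
                     a (suc n) → refl
  ; 0-homo = λ where zero → refl
                     (suc n) → refl
  ; 1-homo = λ _ → refl }
  where
  *-homo : ∀ a b → constant (a *ℤ b) ≗ constant a ⋆ constant b
  *-homo a b zero    = refl
  *-homo a b (suc n) = sym (trans (constant-⋆ a (constant b) (suc n)) (ℤₚ.*-zeroʳ a))

-- Coefficients of monomials and signs.

X : Series
X zero    = 0ℤ
X (suc n) = constant 1ℤ n

open QSeries series constant-homomorphism X
open Exponentiation (CommutativeRing.commutativeSemiring series) using (^-homo-*) renaming (_^_ to _↑_)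

X⋆-suc : ∀ f n → (X ⋆ f) (suc n) ≡ f n
X⋆-suc f n = trans (ℤₚ.+-identityˡ _) (1-⋆ f n)

X↑⋆-+ : ∀ k f n → (X ↑ k ⋆ f) (k + n) ≡ f n
X↑⋆-+ zero    f n = 1-⋆ f n
X↑⋆-+ (suc k) f n = trans (⋆-assoc X (X ↑ k) f (suc (k + n))) (trans (X⋆-suc (X ↑ k ⋆ f) (k + n)) (X↑⋆-+ k f n))

X↑⋆-< : ∀ {k n} f → n < k → (X ↑ k ⋆ f) n ≡ 0ℤ
X↑⋆-< {suc k} {zero}  f _ = ⋆-assoc X (X ↑ k) f 0
X↑⋆-< {suc k} {suc n} f (s≤s n<k) =
  trans (⋆-assoc X (X ↑ k) f (suc n)) (trans (X⋆-suc (X ↑ k ⋆ f) n) (X↑⋆-< f n<k))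

⋆-1 : ∀ f → f ⋆ constant 1ℤ ≗ f
⋆-1 f n = trans (⋆-comm f (constant 1ℤ) n) (1-⋆ f n)

X↑-+ : ∀ k n → (X ↑ k) (k + n) ≡ constant 1ℤ n
X↑-+ k n = trans (sym (⋆-1 (X ↑ k) (k + n))) (X↑⋆-+ k (constant 1ℤ) n)

X↑-< : ∀ {k n} → n < k → (X ↑ k) n ≡ 0ℤ
X↑-< {k} {n} n<k = trans (sym (⋆-1 (X ↑ k) n)) (X↑⋆-< (constant 1ℤ) n<k)

neg-⋆ : ∀ f g n → ((λ k → -ℤ f k) ⋆ g) n ≡ -ℤ (f ⋆ g) n
neg-⋆ f g zero    = sym (ℤₚ.neg-distribˡ-* (f 0) (g 0))
neg-⋆ f g (suc n) = trans
  (cong₂ _+ℤ_ (sym (ℤₚ.neg-distribˡ-* (f 0) (g (suc n)))) (neg-⋆ (f ∘ suc) g n))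
  (sym (ℤₚ.neg-distrib-+ (f 0 *ℤ g (suc n)) _))

negOnePowℕ-suc : ∀ n → negOnePowℕ (suc n) ≡ -ℤ negOnePowℕ n
negOnePowℕ-suc zero          = refl
negOnePowℕ-suc (suc zero)    = refl
negOnePowℕ-suc (suc (suc n)) = negOnePowℕ-suc n

ε-⋆ : ∀ k f n → (ε k ⋆ f) n ≡ negOnePowℕ k *ℤ f n
ε-⋆ zero    f n = constant-⋆ 1ℤ f n
ε-⋆ (suc k) f n = begin
  ((λ i → -ℤ constant 1ℤ i) ⋆ ε k ⋆ f) n       ≡⟨ ⋆-assoc (λ i → -ℤ constant 1ℤ i) (ε k) f n ⟩
  ((λ i → -ℤ constant 1ℤ i) ⋆ (ε k ⋆ f)) n     ≡⟨ neg-⋆ (constant 1ℤ) (ε k ⋆ f) n ⟩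
  -ℤ (constant 1ℤ ⋆ (ε k ⋆ f)) n               ≡⟨ cong -ℤ_ (trans (1-⋆ (ε k ⋆ f) n) (ε-⋆ k f n)) ⟩
  -ℤ (negOnePowℕ k *ℤ f n)                     ≡⟨ ℤₚ.neg-distribˡ-* (negOnePowℕ k) (f n) ⟩
  -ℤ negOnePowℕ k *ℤ f n                       ≡⟨ cong (_*ℤ f n) (negOnePowℕ-suc k) ⟨
  negOnePowℕ (suc k) *ℤ f n                    ∎
  where open ≡-Reasoning

-- Partial sums as division by `1 - X`.

partialSum : Series → ℕ → ℤ
partialSum f zero    = f 0
partialSum f (suc n) = f (suc n) +ℤ partialSum f n

partialSum-cong : ∀ {f g} n → (∀ i → i ≤ n → f i ≡ g i) → partialSum f n ≡ partialSum g n
partialSum-cong zero    p = p 0 z≤n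
partialSum-cong (suc n) p = cong₂ _+ℤ_ (p (suc n) ℕₚ.≤-refl) (partialSum-cong n (λ i i≤n → p i (ℕₚ.m≤n⇒m≤1+n i≤n)))

partialSum-+ : ∀ f g n → partialSum (λ i → f i +ℤ g i) n ≡ partialSum f n +ℤ partialSum g n
partialSum-+ f g zero    = refl
partialSum-+ f g (suc n) = trans (cong (f (suc n) +ℤ g (suc n) +ℤ_) (partialSum-+ f g n)) (rearrange (f (suc n)) (g (suc n)) _ _)
  where
  rearrange : ∀ a b c d → a +ℤ b +ℤ (c +ℤ d) ≡ a +ℤ c +ℤ (b +ℤ d)
  rearrange = solve-∀

partialSum-* : ∀ c f n → partialSum (λ i → c *ℤ f i) n ≡ c *ℤ partialSum f n
partialSum-* c f zero    = refl
partialSum-* c f (suc n) = trans (cong (c *ℤ f (suc n) +ℤ_) (partialSum-* c f n)) (sym (ℤₚ.*-distribˡ-+ c (f (suc n)) _))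

[1-X]⋆-zero : ∀ f → ((constant 1ℤ ⊖ X) ⋆ f) 0 ≡ f 0
[1-X]⋆-zero f = ℤₚ.*-identityˡ (f 0)

[1-X]⋆-suc : ∀ f n → ((constant 1ℤ ⊖ X) ⋆ f) (suc n) ≡ f (suc n) -ℤ f n
[1-X]⋆-suc f n = trans (⋆-distribʳ f (constant 1ℤ) (λ i → -ℤ X i) (suc n))
  (cong₂ _+ℤ_ (1-⋆ f (suc n)) (trans (neg-⋆ X f (suc n)) (cong -ℤ_ (X⋆-suc f n))))

partialSum-[1-X]⋆ : ∀ f n → partialSum ((constant 1ℤ ⊖ X) ⋆ f) n ≡ f n
partialSum-[1-X]⋆ f zero    = [1-X]⋆-zero f
partialSum-[1-X]⋆ f (suc n) = trans
  (cong₂ _+ℤ_ ([1-X]⋆-suc f n) (partialSum-[1-X]⋆ f n))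
  (rearrange (f (suc n)) (f n))
  where
  rearrange : ∀ a b → a -ℤ b +ℤ b ≡ a
  rearrange = solve-∀

partialSum-X↑-< : ∀ {k} n → n < k → partialSum (X ↑ k) n ≡ 0ℤ
partialSum-X↑-< zero    n<k = X↑-< n<k
partialSum-X↑-< (suc n) n<k = cong₂ _+ℤ_ (X↑-< n<k) (partialSum-X↑-< n (ℕₚ.<⇒≤ n<k))

partialSum-X↑-+ : ∀ k n → partialSum (X ↑ k) (k + n) ≡ 1ℤ
partialSum-X↑-+ zero    zero    = refl
partialSum-X↑-+ (suc k) zero    = cong₂ _+ℤ_ (X↑-+ (suc k) 0) (partialSum-X↑-< (k + 0) (s≤s (ℕₚ.≤-reflexive (ℕₚ.+-identityʳ k))))
partialSum-X↑-+ k       (suc n) rewrite ℕₚ.+-suc k n = cong₂ _+ℤ_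
  (trans (cong (X ↑ k) (sym (ℕₚ.+-suc k n))) (X↑-+ k (suc n))) (partialSum-X↑-+ k n)

partialSum-X↑-≤ : ∀ {k n} → k ≤ n → partialSum (X ↑ k) n ≡ 1ℤ
partialSum-X↑-≤ {k} k≤n = subst (λ i → partialSum (X ↑ k) i ≡ 1ℤ) (ℕₚ.m+[n∸m]≡n k≤n) (partialSum-X↑-+ k _)

mod⇒coefficients : ∀ {f g k} → f ≈ g mod-q^ k → ∀ {i} → i < k → f i ≡ g i
mod⇒coefficients {g = g} (r , eq) {i} i<k = trans (eq i) (trans (cong (g i +ℤ_) (X↑⋆-< r i<k)) (ℤₚ.+-identityʳ (g i)))

partialSum-neg : ∀ f n → partialSum (λ i → -ℤ f i) n ≡ -ℤ partialSum f n
partialSum-neg f zero    = refl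
partialSum-neg f (suc n) = trans (cong (-ℤ f (suc n) +ℤ_) (partialSum-neg f n)) (sym (ℤₚ.neg-distrib-+ (f (suc n)) _))

-- A congruence modulo `q^(n+1)` fixes the coefficients of degree at most `n`, exactly those that
-- enter a partial sum up to `n`; multiplication by `1 - X` telescopes under that sum.
divide-[1-X] : ∀ f g h n → (constant 1ℤ ⊖ X) ⋆ f ≈ (constant 1ℤ ⊖ X) ⋆ g ⊖ h mod-q^ suc n →
  f n ≡ g n -ℤ partialSum h n
divide-[1-X] f g h n eq = begin
  f n
    ≡⟨ partialSum-[1-X]⋆ f n ⟨
  partialSum ((constant 1ℤ ⊖ X) ⋆ f) n
    ≡⟨ partialSum-cong n (λ i i≤n → mod⇒coefficients eq (s≤s i≤n)) ⟩
  partialSum ((constant 1ℤ ⊖ X) ⋆ g ⊖ h) n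
    ≡⟨ partialSum-+ ((constant 1ℤ ⊖ X) ⋆ g) (λ i → -ℤ h i) n ⟩
  partialSum ((constant 1ℤ ⊖ X) ⋆ g) n +ℤ partialSum (λ i → -ℤ h i) n
    ≡⟨ cong₂ _+ℤ_ (partialSum-[1-X]⋆ g n) (partialSum-neg h n) ⟩
  g n -ℤ partialSum h n ∎
  where open ≡-Reasoning

W₂-coefficient : ∀ n → W₂ n 0 n ≡ euler n n -ℤ partialSum (θ n) n
W₂-coefficient n = divide-[1-X] (W₂ n 0) (euler n) (θ n) n (W₂≈euler-θ n)

-- Partial sums of the theta series.

partialSum-θ-suc : ∀ j n → partialSum (θ (suc j)) n ≡ partialSum (θ j) n +ℤ ℤ.+ 2 *ℤ (negOnePowℕ (suc j) *ℤ partialSum (X ↑ (suc j * suc j)) n)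
partialSum-θ-suc j n = begin
  partialSum (θ (suc j)) n
    ≡⟨ partialSum-cong n (λ i _ → cong (θ j i +ℤ_) (two i)) ⟩
  partialSum (λ i → θ j i +ℤ ℤ.+ 2 *ℤ (s *ℤ (X ↑ k) i)) n
    ≡⟨ partialSum-+ (θ j) (λ i → ℤ.+ 2 *ℤ (s *ℤ (X ↑ k) i)) n ⟩
  partialSum (θ j) n +ℤ partialSum (λ i → ℤ.+ 2 *ℤ (s *ℤ (X ↑ k) i)) n
    ≡⟨ cong (partialSum (θ j) n +ℤ_) (trans (partialSum-* (ℤ.+ 2) (λ i → s *ℤ (X ↑ k) i) n) (cong (ℤ.+ 2 *ℤ_) (partialSum-* s (X ↑ k) n))) ⟩
  partialSum (θ j) n +ℤ ℤ.+ 2 *ℤ (s *ℤ partialSum (X ↑ k) n) ∎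
  where
  open ≡-Reasoning
  k = suc j * suc j
  s = negOnePowℕ (suc j)
  two : ∀ i → ((λ l → constant 1ℤ l +ℤ constant 1ℤ l) ⋆ (ε (suc j) ⋆ X ↑ k)) i ≡ ℤ.+ 2 *ℤ (s *ℤ (X ↑ k) i)
  two i = trans (⋆-distribʳ (ε (suc j) ⋆ X ↑ k) (constant 1ℤ) (constant 1ℤ) i)
    (trans (cong₂ _+ℤ_ (1-⋆ (ε (suc j) ⋆ X ↑ k) i) (1-⋆ (ε (suc j) ⋆ X ↑ k) i))
      (trans (double _) (cong (ℤ.+ 2 *ℤ_) (ε-⋆ (suc j) (X ↑ k) i))))
    where
    double : ∀ a → a +ℤ a ≡ ℤ.+ 2 *ℤ a
    double = solve-∀

-- While the squares stay within range, each new term turns `a` into `a - 2a`, which only flips the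
-- sign.
partialSum-θ-≤ : ∀ j n → j * j ≤ n → partialSum (θ j) n ≡ negOnePowℕ j
partialSum-θ-≤ zero    n _    = partialSum-X↑-+ 0 n
partialSum-θ-≤ (suc j) n j²≤n = begin
  partialSum (θ (suc j)) n
    ≡⟨ partialSum-θ-suc j n ⟩
  partialSum (θ j) n +ℤ ℤ.+ 2 *ℤ (negOnePowℕ (suc j) *ℤ partialSum (X ↑ (suc j * suc j)) n)
    ≡⟨ cong₂ (λ a b → a +ℤ ℤ.+ 2 *ℤ b) (partialSum-θ-≤ j n (ℕₚ.≤-trans (ℕₚ.*-mono-≤ (ℕₚ.n≤1+n j) (ℕₚ.n≤1+n j)) j²≤n)) (cong₂ _*ℤ_ (negOnePowℕ-suc j) (partialSum-X↑-≤ j²≤n)) ⟩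
  negOnePowℕ j +ℤ ℤ.+ 2 *ℤ (-ℤ negOnePowℕ j *ℤ 1ℤ)
    ≡⟨ rearrange (negOnePowℕ j) ⟩
  -ℤ negOnePowℕ j
    ≡⟨ negOnePowℕ-suc j ⟨
  negOnePowℕ (suc j) ∎
  where
  open ≡-Reasoning
  rearrange : ∀ a → a +ℤ ℤ.+ 2 *ℤ (-ℤ a *ℤ 1ℤ) ≡ -ℤ a
  rearrange = solve-∀

partialSum-θ : ∀ ℓ d n → ℓ * ℓ ≤ n → n < suc ℓ * suc ℓ → partialSum (θ (d + ℓ)) n ≡ negOnePowℕ ℓ
partialSum-θ ℓ zero    n lower upper = partialSum-θ-≤ ℓ n lower
partialSum-θ ℓ (suc d) n lower upper = begin
  partialSum (θ (suc d + ℓ)) n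
    ≡⟨ partialSum-θ-suc (d + ℓ) n ⟩
  partialSum (θ (d + ℓ)) n +ℤ ℤ.+ 2 *ℤ (s *ℤ partialSum (X ↑ (suc (d + ℓ) * suc (d + ℓ))) n)
    ≡⟨ cong₂ (λ a b → a +ℤ ℤ.+ 2 *ℤ (s *ℤ b)) (partialSum-θ ℓ d n lower upper)
         (partialSum-X↑-< n (ℕₚ.<-≤-trans upper (ℕₚ.*-mono-≤ (s≤s (ℕₚ.m≤n+m ℓ d)) (s≤s (ℕₚ.m≤n+m ℓ d))))) ⟩
  negOnePowℕ ℓ +ℤ ℤ.+ 2 *ℤ (s *ℤ 0ℤ)
    ≡⟨ rearrange (negOnePowℕ ℓ) s ⟩
  negOnePowℕ ℓ ∎
  where
  open ≡-Reasoning
  s = negOnePowℕ (suc (d + ℓ))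
  rearrange : ∀ a b → a +ℤ ℤ.+ 2 *ℤ (b *ℤ 0ℤ) ≡ a
  rearrange = solve-∀

-- Coefficients of the pentagonal series.

X↑-≡ : ∀ k → (X ↑ k) k ≡ 1ℤ
X↑-≡ k = trans (cong (X ↑ k) (sym (ℕₚ.+-identityʳ k))) (X↑-+ k 0)

X↑-≢ : ∀ k n → n ≢ k → (X ↑ k) n ≡ 0ℤ
X↑-≢ k n n≢k with k ≤? n
... | no k≰n  = X↑-< (ℕₚ.≰⇒> k≰n)
... | yes k≤n with n ∸ k in eq
...   | zero  = contradiction (ℕₚ.≤-antisym (ℕₚ.m∸n≡0⇒m≤n eq) k≤n) n≢k
...   | suc d = subst (λ i → (X ↑ k) i ≡ 0ℤ) (trans (cong (k +_) (sym eq)) (ℕₚ.m+[n∸m]≡n k≤n)) (X↑-+ k (suc d))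

euler-suc : ∀ j n → euler (suc j) n ≡
  euler j n +ℤ negOnePowℕ (suc j) *ℤ ((X ↑ pentagonal (suc j)) n +ℤ (X ↑ (pentagonal (suc j) + suc j)) n)
euler-suc j n = cong (euler j n +ℤ_) (trans (ε-⋆ (suc j) (X ↑ p ⋆ (λ i → constant 1ℤ i +ℤ (X ↑ suc j) i)) n)
  (cong (negOnePowℕ (suc j) *ℤ_) (trans (⋆-distribˡ (X ↑ p) (constant 1ℤ) (X ↑ suc j) n)
    (cong₂ _+ℤ_ (⋆-1 (X ↑ p) n) (sym (^-homo-* X p (suc j) n))))))
  where p = pentagonal (suc j)

_isPentagonal_ : ℕ → ℕ → Set
n isPentagonal j = n ≡ pentagonal j ⊎ n ≡ pentagonal j + j

euler-suc-≢ : ∀ j n → ¬ (n isPentagonal suc j) → euler (suc j) n ≡ euler j n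
euler-suc-≢ j n n≢ = begin
  euler (suc j) n                                        ≡⟨ euler-suc j n ⟩
  euler j n +ℤ s *ℤ ((X ↑ p) n +ℤ (X ↑ (p + suc j)) n)   ≡⟨ cong₂ (λ a b → euler j n +ℤ s *ℤ (a +ℤ b)) (X↑-≢ p n (n≢ ∘ inj₁)) (X↑-≢ (p + suc j) n (n≢ ∘ inj₂)) ⟩
  euler j n +ℤ s *ℤ 0ℤ                                   ≡⟨ cong (euler j n +ℤ_) (ℤₚ.*-zeroʳ s) ⟩
  euler j n +ℤ 0ℤ                                        ≡⟨ ℤₚ.+-identityʳ (euler j n) ⟩
  euler j n                                              ∎
  where
  open ≡-Reasoning
  p = pentagonal (suc j)
  s = negOnePowℕ (suc j)

euler-suc-≡ : ∀ j n → n isPentagonal suc j → euler (suc j) n ≡ euler j n +ℤ negOnePowℕ (suc j)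
euler-suc-≡ j n n≡ = trans (euler-suc j n) (cong (euler j n +ℤ_) (trans (cong (negOnePowℕ (suc j) *ℤ_) (one n≡)) (ℤₚ.*-identityʳ _)))
  where
  p = pentagonal (suc j)
  one : n isPentagonal suc j → (X ↑ p) n +ℤ (X ↑ (p + suc j)) n ≡ 1ℤ
  -- The two exponents differ by `suc j > 0`, so exactly one of the monomials contributes.
  one (inj₁ refl) = cong₂ _+ℤ_ (X↑-≡ p) (X↑-≢ (p + suc j) p (ℕₚ.m≢1+m+n p ∘ (λ eq → trans eq (ℕₚ.+-suc p j))))
  one (inj₂ refl) = cong₂ _+ℤ_ (X↑-≢ p (p + suc j) (ℕₚ.m≢1+m+n p ∘ (λ eq → trans (sym eq) (ℕₚ.+-suc p j)))) (X↑-≡ (p + suc j))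

-- For positive `j` both sides contain `triangular j`, and only the squares differ. The gap ensures
-- that a given `n` belongs to a single index, so at most one sign enters its coefficient.
pentagonal-< : ∀ j → pentagonal j + j < pentagonal (suc j)
pentagonal-< zero    = s≤s z≤n
pentagonal-< (suc i) = begin-strict
  suc i * suc i + triangular i + suc i                       ≡⟨ ℕₚ.+-assoc (suc i * suc i) _ _ ⟩
  suc i * suc i + (triangular i + suc i)                     ≡⟨ cong (suc i * suc i +_) (ℕₚ.+-comm (triangular i) (suc i)) ⟩
  suc i * suc i + triangular (suc i)                         <⟨ ℕₚ.+-monoˡ-< (triangular (suc i)) (ℕₚ.*-mono-< (ℕₚ.n<1+n (suc i)) (ℕₚ.n<1+n (suc i))) ⟩
  suc (suc i) * suc (suc i) + triangular (suc i)             ∎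
  where open ℕₚ.≤-Reasoning

pentagonal-mono-< : ∀ {i j} → i < j → pentagonal i + i < pentagonal j
pentagonal-mono-< {i} {suc j} (s≤s i≤j) with ℕₚ.m≤n⇒m<n∨m≡n i≤j
... | inj₁ i<j  = ℕₚ.<-trans (pentagonal-mono-< i<j) (ℕₚ.≤-<-trans (ℕₚ.m≤m+n _ j) (pentagonal-< j))
... | inj₂ refl = pentagonal-< i

isPentagonal⇒≥ : ∀ {n} j → n isPentagonal j → pentagonal j ≤ n
isPentagonal⇒≥ j (inj₁ refl) = ℕₚ.≤-refl
isPentagonal⇒≥ j (inj₂ refl) = ℕₚ.m≤m+n _ _

isPentagonal⇒≤ : ∀ {n} j → n isPentagonal j → n ≤ pentagonal j + j
isPentagonal⇒≤ j (inj₁ refl) = ℕₚ.m≤m+n _ _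
isPentagonal⇒≤ j (inj₂ refl) = ℕₚ.≤-refl

isPentagonal-unique : ∀ {n} i j → n isPentagonal i → n isPentagonal j → ¬ i < j
isPentagonal-unique i j p p′ i<j =
  ℕₚ.<-irrefl refl (ℕₚ.≤-<-trans (isPentagonal⇒≤ i p) (ℕₚ.<-≤-trans (pentagonal-mono-< i<j) (isPentagonal⇒≥ j p′)))

j≤pentagonal : ∀ j → j ≤ pentagonal j
j≤pentagonal zero    = z≤n
j≤pentagonal (suc j) = ℕₚ.≤-trans (ℕₚ.m≤m*n (suc j) (suc j)) (ℕₚ.m≤m+n _ _)

euler-below : ∀ j n → 1 ≤ n → (∀ i → 1 ≤ i → i ≤ j → ¬ (n isPentagonal i)) → euler j n ≡ 0ℤ
euler-below zero    (suc n) _   _   = refl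
euler-below (suc j) n       1≤n n≢  = trans (euler-suc-≢ j n (n≢ (suc j) (s≤s z≤n) ℕₚ.≤-refl))
  (euler-below j n 1≤n (λ i 1≤i i≤j → n≢ i 1≤i (ℕₚ.m≤n⇒m≤1+n i≤j)))

euler-above : ∀ d j n → 1 ≤ n → n isPentagonal suc j → euler (d + suc j) n ≡ negOnePowℕ (suc j)
euler-above zero    j n 1≤n n≡ = trans (euler-suc-≡ j n n≡)
  (trans (cong (_+ℤ negOnePowℕ (suc j)) (euler-below j n 1≤n (λ i _ i≤j n≡′ → isPentagonal-unique i (suc j) n≡′ n≡ (s≤s i≤j)))) (ℤₚ.+-identityˡ _))
euler-above (suc d) j n 1≤n n≡ = trans
  (euler-suc-≢ (d + suc j) n (λ n≡′ → isPentagonal-unique (suc j) (suc (d + suc j)) n≡ n≡′ (s≤s (ℕₚ.m≤n+m (suc j) d))))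
  (euler-above d j n 1≤n n≡)

euler-pentagonal : ∀ n j → 1 ≤ n → 1 ≤ j → n isPentagonal j → euler n n ≡ negOnePowℕ j
euler-pentagonal n (suc j) 1≤n _ n≡ = subst (λ i → euler i n ≡ negOnePowℕ (suc j))
  (ℕₚ.m∸n+n≡m (ℕₚ.≤-trans (j≤pentagonal (suc j)) (isPentagonal⇒≥ (suc j) n≡)))
  (euler-above (n ∸ suc j) j n 1≤n n≡)

2*triangular : ∀ n → 2 * triangular n ≡ n * suc n
2*triangular zero    = refl
2*triangular (suc n) = begin
  2 * (suc n + triangular n)       ≡⟨ ℕₚ.*-distribˡ-+ 2 (suc n) (triangular n) ⟩
  2 * suc n + 2 * triangular n     ≡⟨ cong (2 * suc n +_) (2*triangular n) ⟩
  2 * suc n + n * suc n            ≡⟨ rearrange n ⟩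
  suc n * suc (suc n)              ∎
  where
  open ≡-Reasoning
  rearrange : ∀ n → 2 * suc n + n * suc n ≡ suc n * suc (suc n)
  rearrange = ℕ-RingSolver.solve-∀

2*pentagonal : ∀ j → 2 * pentagonal j + j ≡ 3 * j * j
2*pentagonal zero    = refl
2*pentagonal (suc i) = begin
  2 * (suc i * suc i + triangular i) + suc i           ≡⟨ cong (_+ suc i) (ℕₚ.*-distribˡ-+ 2 (suc i * suc i) (triangular i)) ⟩
  2 * (suc i * suc i) + 2 * triangular i + suc i       ≡⟨ cong (λ t → 2 * (suc i * suc i) + t + suc i) (2*triangular i) ⟩
  2 * (suc i * suc i) + i * suc i + suc i              ≡⟨ rearrange i ⟩
  3 * suc i * suc i                                    ∎
  where
  open ≡-Reasoning
  rearrange : ∀ i → 2 * (suc i * suc i) + i * suc i + suc i ≡ 3 * suc i * suc i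
  rearrange = ℕ-RingSolver.solve-∀

2*[pentagonal+j] : ∀ j → 2 * (pentagonal j + j) ≡ j * (3 * j + 1)
2*[pentagonal+j] j = begin
  2 * (pentagonal j + j)       ≡⟨ distribute (pentagonal j) j ⟩
  2 * pentagonal j + j + j     ≡⟨ cong (_+ j) (2*pentagonal j) ⟩
  3 * j * j + j                ≡⟨ rearrange j ⟩
  j * (3 * j + 1)              ∎
  where
  open ≡-Reasoning
  distribute : ∀ p j → 2 * (p + j) ≡ 2 * p + j + j
  distribute = ℕ-RingSolver.solve-∀
  rearrange : ∀ j → 3 * j * j + j ≡ j * (3 * j + 1)
  rearrange = ℕ-RingSolver.solve-∀

IsPentagonalFor⇒isPentagonal : ∀ n j → IsPentagonalFor n j → n isPentagonal j
IsPentagonalFor⇒isPentagonal n j (inj₁ eq) = inj₂ (ℕₚ.*-cancelˡ-≡ n _ 2 (trans eq (sym (2*[pentagonal+j] j))))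
IsPentagonalFor⇒isPentagonal n j (inj₂ eq) = inj₁ (ℕₚ.*-cancelˡ-≡ n _ 2 (ℕₚ.+-cancelʳ-≡ j _ _ (trans eq (sym (2*pentagonal j)))))

isPentagonal⇒IsPentagonalFor : ∀ n j → n isPentagonal j → IsPentagonalFor n j
isPentagonal⇒IsPentagonalFor n j (inj₁ refl) = inj₂ (2*pentagonal j)
isPentagonal⇒IsPentagonalFor n j (inj₂ refl) = inj₁ (2*[pentagonal+j] j)

-- Enumeration of the partitions into distinct parts.

-- The list counterpart of multiplication by `X ↑ k`: it yields `F (n ∸ k)`, but the empty list when
-- `n < k`.
delay : ∀ {A : Set} → ℕ → (ℕ → List A) → ℕ → List A
delay zero    F n       = F n
delay (suc k) F zero    = []
delay (suc k) F (suc n) = delay k F n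

∈-delay⁺ : ∀ {A : Set} {x : A} k F n → x ∈ F n → x ∈ delay k F (k + n)
∈-delay⁺ zero    F n x∈ = x∈
∈-delay⁺ (suc k) F n x∈ = ∈-delay⁺ k F n x∈

∈-delay⁻ : ∀ {A : Set} {x : A} k F n → x ∈ delay k F n → ∃[ i ] (n ≡ k + i × x ∈ F i)
∈-delay⁻ zero    F n       x∈ = n , refl , x∈
∈-delay⁻ (suc k) F (suc n) x∈ with ∈-delay⁻ k F n x∈
... | i , refl , x∈F = i , refl , x∈F

delay-unique : ∀ {A : Set} k (F : ℕ → List A) n → (∀ i → Unique (F i)) → Unique (delay k F n)
delay-unique zero    F n       u = u n
delay-unique (suc k) F zero    u = AllPairs.[]
delay-unique (suc k) F (suc n) u = delay-unique k F n u

-- The partitions of n into distinct parts from {m+1, …, m+k}.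
partitions : ℕ → ℕ → ℕ → List (List ℕ)
partitions zero    m zero    = [] ∷ []
partitions zero    m (suc n) = []
partitions (suc k) m n       = partitions k (suc m) n ++ map (suc m ∷_) (delay (suc m) (partitions k (suc m)) n)

DistinctAbove : ℕ → ℕ → List ℕ → Set
DistinctAbove m n π = Linked _<_ π × All (m <_) π × sum π ≡ n

∷-Linked : ∀ {x π} → All (x <_) π → Linked _<_ π → Linked _<_ (x ∷ π)
∷-Linked []         _      = [-]
∷-Linked (x<y ∷ _)  linked = x<y ∷ linked

∈-partitions⁻ : ∀ k m n {π} → π ∈ partitions k m n → DistinctAbove m n π
∈-partitions⁻ zero m zero (here refl) = [] , [] , refl
∈-partitions⁻ (suc k) m n π∈ with ∈-++⁻ (partitions k (suc m) n) π∈
... | inj₁ π∈ˡ with ∈-partitions⁻ k (suc m) n π∈ˡ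
...   | linked , above , total = linked , All.map ℕₚ.<⇒≤ above , total
∈-partitions⁻ (suc k) m n π∈ | inj₂ π∈ʳ with ∈-map⁻ (suc m ∷_) π∈ʳ
...   | ρ , ρ∈ , refl with ∈-delay⁻ (suc m) (partitions k (suc m)) n ρ∈
...     | i , refl , ρ∈′ with ∈-partitions⁻ k (suc m) i ρ∈′
...       | linked , above , refl = ∷-Linked above linked , ℕₚ.≤-refl ∷ All.map ℕₚ.<⇒≤ above , refl

∈-partitions⁺ : ∀ k m n {π} → DistinctAbove m n π → All (_≤ m + k) π → π ∈ partitions k m n
∈-partitions⁺ zero    m n {[]}    (_ , _ , refl) _ = here refl
∈-partitions⁺ zero    m n {x ∷ π} (_ , m<x ∷ _ , _) (x≤m ∷ _) =
  contradiction (ℕₚ.≤-trans m<x (subst (x ≤_) (ℕₚ.+-identityʳ m) x≤m)) (ℕₚ.<-irrefl refl)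
∈-partitions⁺ (suc k) m n {[]}    (_ , _ , refl) _ = ∈-++⁺ˡ (∈-partitions⁺ k (suc m) 0 ([] , [] , refl) [])
∈-partitions⁺ (suc k) m n {x ∷ π} (linked , m<x ∷ above , refl) bounds
  rewrite ℕₚ.+-suc m k with ℕₚ.m≤n⇒m<n∨m≡n m<x
... | inj₁ m+1<x = ∈-++⁺ˡ (∈-partitions⁺ k (suc m) _ (linked , Linked⇒All ℕₚ.<-trans m+1<x linked , refl) bounds)
... | inj₂ refl  = ∈-++⁺ʳ (partitions k (suc m) (x + sum π)) (∈-map⁺ (suc m ∷_)
        (∈-delay⁺ (suc m) (partitions k (suc m)) (sum π)
          (∈-partitions⁺ k (suc m) (sum π)
            (Linked.tail linked , AllPairs.head (Linked⇒AllPairs ℕₚ.<-trans linked) , refl) (All.tail bounds))))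

partitions-unique : ∀ k m n → Unique (partitions k m n)
partitions-unique zero    m zero    = [] AllPairs.∷ AllPairs.[]
partitions-unique zero    m (suc n) = AllPairs.[]
partitions-unique (suc k) m n       = Unique.++⁺
  (partitions-unique k (suc m) n)
  (Unique.map⁺ ∷-injectiveʳ (delay-unique (suc m) (partitions k (suc m)) n (partitions-unique k (suc m))))
  disjoint
  where
  disjoint : ∀ {π} → ¬ (π ∈ partitions k (suc m) n × π ∈ map (suc m ∷_) (delay (suc m) (partitions k (suc m)) n))
  disjoint (π∈ˡ , π∈ʳ) with ∈-map⁻ (suc m ∷_) π∈ʳ
  ... | _ , _ , refl with ∈-partitions⁻ k (suc m) n π∈ˡ
  ...   | _ , m+1<m+1 ∷ _ , _ = ℕₚ.<-irrefl refl m+1<m+1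

parts≤sum : ∀ π → All (_≤ sum π) π
parts≤sum []      = []
parts≤sum (x ∷ π) = ℕₚ.m≤m+n x (sum π) ∷ All.map (λ y≤ → ℕₚ.≤-trans y≤ (ℕₚ.m≤n+m (sum π) x)) (parts≤sum π)

∈-partitions⇔ : ∀ n π → π ∈ partitions n 0 n ⇔ IsDistinctPartition n π
∈-partitions⇔ n π = mk⇔ (∈-partitions⁻ n 0 n)
  (λ where d@(_ , _ , refl) → ∈-partitions⁺ n 0 n d (parts≤sum π))

-- Signed sums over partitions as power series.

sumℤ-++ : ∀ xs ys → sumℤ (xs ++ ys) ≡ sumℤ xs +ℤ sumℤ ys
sumℤ-++ []       ys = sym (ℤₚ.+-identityˡ (sumℤ ys))
sumℤ-++ (x ∷ xs) ys = trans (cong (x +ℤ_) (sumℤ-++ xs ys)) (sym (ℤₚ.+-assoc x (sumℤ xs) (sumℤ ys)))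

sumℤ-↭ : ∀ {xs ys} → xs ↭ ys → sumℤ xs ≡ sumℤ ys
sumℤ-↭ p = foldr-commMonoid (setoid ℤ) ℤₚ.+-0-isCommutativeMonoid (↭⇒↭ₛ p)

weightSeries : (List ℕ → ℤ) → ℕ → ℕ → Series
weightSeries w k m n = sumℤ (map w (partitions k m n))

sumℤ-delay : ∀ (v : List ℕ → ℤ) k F n → sumℤ (map v (delay k F n)) ≡ (X ↑ k ⋆ (λ i → sumℤ (map v (F i)))) n
sumℤ-delay v zero    F n       = sym (1-⋆ (λ i → sumℤ (map v (F i))) n)
sumℤ-delay v (suc k) F zero    = sym (X↑⋆-< {suc k} (λ i → sumℤ (map v (F i))) (s≤s z≤n))
sumℤ-delay v (suc k) F (suc n) = trans (sumℤ-delay v k F n)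
  (sym (trans (⋆-assoc X (X ↑ k) f (suc n)) (X⋆-suc (X ↑ k ⋆ f) n)))
  where f = λ i → sumℤ (map v (F i))

weightSeries-suc : ∀ w k m n → weightSeries w (suc k) m n ≡
  weightSeries w k (suc m) n +ℤ (X ↑ suc m ⋆ weightSeries (w ∘ (suc m ∷_)) k (suc m)) n
weightSeries-suc w k m n = begin
  sumℤ (map w (partitions k (suc m) n ++ map (suc m ∷_) D))                      ≡⟨ cong sumℤ (map-++ w (partitions k (suc m) n) _) ⟩
  sumℤ (map w (partitions k (suc m) n) ++ map w (map (suc m ∷_) D))              ≡⟨ sumℤ-++ (map w (partitions k (suc m) n)) _ ⟩
  weightSeries w k (suc m) n +ℤ sumℤ (map w (map (suc m ∷_) D))                  ≡⟨ cong (λ xs → weightSeries w k (suc m) n +ℤ sumℤ xs) (sym (map-∘ D)) ⟩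
  weightSeries w k (suc m) n +ℤ sumℤ (map (w ∘ (suc m ∷_)) D)                    ≡⟨ cong (weightSeries w k (suc m) n +ℤ_) (sumℤ-delay (w ∘ (suc m ∷_)) (suc m) (partitions k (suc m)) n) ⟩
  weightSeries w k (suc m) n +ℤ (X ↑ suc m ⋆ weightSeries (w ∘ (suc m ∷_)) k (suc m)) n ∎
  where
  open ≡-Reasoning
  D = delay (suc m) (partitions k (suc m)) n

sumℤ-scale : ∀ c (w v : List ℕ → ℤ) → (∀ π → v π ≡ c *ℤ w π) → ∀ πs → sumℤ (map v πs) ≡ c *ℤ sumℤ (map w πs)
sumℤ-scale c w v eq []       = sym (ℤₚ.*-zeroʳ c)
sumℤ-scale c w v eq (π ∷ πs) = trans (cong₂ _+ℤ_ (eq π) (sumℤ-scale c w v eq πs)) (sym (ℤₚ.*-distribˡ-+ c (w π) _))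

⋆-scaleʳ : ∀ c f g → f ⋆ (λ k → c *ℤ g k) ≗ λ n → c *ℤ (f ⋆ g) n
⋆-scaleʳ c f g n = trans (⋆-comm f _ n) (trans (⋆-scaleˡ c g f n) (cong (c *ℤ_) (⋆-comm g f n)))

-- Prepending a part turns `w₂` into `w₁`, `w₁` into a signed `w₀`, and `w₀` into its negative,
-- matching the recursions of `W₂`, `W₁` and `C`. The value 0 on the empty list makes `w₂` vanish on
-- lists with fewer than two parts, so the sum may range over all partitions.
w₀ w₁ w₂ : List ℕ → ℤ
w₀ π       = negOnePowℕ (length π)
w₁ []      = 0ℤ
w₁ (y ∷ π) = negOnePowℕ y *ℤ w₀ π
w₂ []      = 0ℤ
w₂ (x ∷ π) = w₁ π

weightSeries-w₀ : ∀ k m → weightSeries w₀ k m ≗ C k m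
weightSeries-w₀ zero    m zero    = refl
weightSeries-w₀ zero    m (suc n) = refl
weightSeries-w₀ (suc k) m n       = begin
  weightSeries w₀ (suc k) m n
    ≡⟨ weightSeries-suc w₀ k m n ⟩
  weightSeries w₀ k (suc m) n +ℤ (X ↑ suc m ⋆ weightSeries (w₀ ∘ (suc m ∷_)) k (suc m)) n
    ≡⟨ cong₂ _+ℤ_ (weightSeries-w₀ k (suc m) n) (⋆-cong {X ↑ suc m} (λ _ → refl) flip n) ⟩
  C k (suc m) n +ℤ (X ↑ suc m ⋆ (λ i → -ℤ 1ℤ *ℤ C k (suc m) i)) n
    ≡⟨ cong₂ _+ℤ_ (sym (1-⋆ (C k (suc m)) n)) (trans (⋆-scaleʳ (-ℤ 1ℤ) (X ↑ suc m) (C k (suc m)) n) (trans (ℤₚ.-1*i≡-i _) (sym (neg-⋆ (X ↑ suc m) (C k (suc m)) n)))) ⟩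
  (constant 1ℤ ⋆ C k (suc m)) n +ℤ ((λ i → -ℤ (X ↑ suc m) i) ⋆ C k (suc m)) n
    ≡⟨ ⋆-distribʳ (C k (suc m)) (constant 1ℤ) (λ i → -ℤ (X ↑ suc m) i) n ⟨
  C (suc k) m n ∎
  where
  open ≡-Reasoning
  flip : weightSeries (w₀ ∘ (suc m ∷_)) k (suc m) ≗ λ i → -ℤ 1ℤ *ℤ C k (suc m) i
  flip i = trans
    (sumℤ-scale (-ℤ 1ℤ) w₀ (w₀ ∘ (suc m ∷_)) (λ π → trans (negOnePowℕ-suc (length π)) (sym (ℤₚ.-1*i≡-i _))) (partitions k (suc m) i))
    (cong (-ℤ 1ℤ *ℤ_) (weightSeries-w₀ k (suc m) i))

weightSeries-w₁ : ∀ k m → weightSeries w₁ k m ≗ W₁ k m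
weightSeries-w₁ zero    m zero    = refl
weightSeries-w₁ zero    m (suc n) = refl
weightSeries-w₁ (suc k) m n       = begin
  weightSeries w₁ (suc k) m n
    ≡⟨ weightSeries-suc w₁ k m n ⟩
  weightSeries w₁ k (suc m) n +ℤ (X ↑ suc m ⋆ weightSeries (w₁ ∘ (suc m ∷_)) k (suc m)) n
    ≡⟨ cong₂ _+ℤ_ (weightSeries-w₁ k (suc m) n) (⋆-cong {X ↑ suc m} (λ _ → refl) scale n) ⟩
  W₁ k (suc m) n +ℤ (X ↑ suc m ⋆ (λ i → s *ℤ C k (suc m) i)) n
    ≡⟨ cong (W₁ k (suc m) n +ℤ_) (trans (⋆-scaleʳ s (X ↑ suc m) (C k (suc m)) n) (sym (ε-⋆ (suc m) (X ↑ suc m ⋆ C k (suc m)) n))) ⟩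
  W₁ (suc k) m n ∎
  where
  open ≡-Reasoning
  s = negOnePowℕ (suc m)
  scale : weightSeries (w₁ ∘ (suc m ∷_)) k (suc m) ≗ λ i → s *ℤ C k (suc m) i
  scale i = trans (sumℤ-scale s w₀ (w₁ ∘ (suc m ∷_)) (λ _ → refl) (partitions k (suc m) i))
    (cong (s *ℤ_) (weightSeries-w₀ k (suc m) i))

weightSeries-w₂ : ∀ k m → weightSeries w₂ k m ≗ W₂ k m
weightSeries-w₂ zero    m zero    = refl
weightSeries-w₂ zero    m (suc n) = refl
weightSeries-w₂ (suc k) m n       = trans (weightSeries-suc w₂ k m n)
  (cong₂ _+ℤ_ (weightSeries-w₂ k (suc m) n) (⋆-cong {X ↑ suc m} (λ _ → refl) (weightSeries-w₁ k (suc m)) n))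

-- Evaluation of the sum over partitions with at least two parts.

negOnePow-⊖ : ∀ m n → negOnePowℕ ∣ m ℤ.⊖ n ∣ ≡ negOnePowℕ n *ℤ negOnePowℕ m
negOnePow-⊖ zero    zero    = refl
negOnePow-⊖ zero    (suc n) = sym (ℤₚ.*-identityʳ _)
negOnePow-⊖ (suc m) zero    = sym (ℤₚ.*-identityˡ _)
negOnePow-⊖ (suc m) (suc n) = begin
  negOnePowℕ ∣ suc m ℤ.⊖ suc n ∣                     ≡⟨ cong (negOnePowℕ ∘ ∣_∣) (ℤₚ.[1+m]⊖[1+n]≡m⊖n m n) ⟩
  negOnePowℕ ∣ m ℤ.⊖ n ∣                             ≡⟨ negOnePow-⊖ m n ⟩
  negOnePowℕ n *ℤ negOnePowℕ m                     ≡⟨ negate (negOnePowℕ n) (negOnePowℕ m) ⟩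
  -ℤ negOnePowℕ n *ℤ -ℤ negOnePowℕ m               ≡⟨ cong₂ _*ℤ_ (negOnePowℕ-suc n) (negOnePowℕ-suc m) ⟨
  negOnePowℕ (suc n) *ℤ negOnePowℕ (suc m)         ∎
  where
  open ≡-Reasoning
  negate : ∀ a b → a *ℤ b ≡ -ℤ a *ℤ -ℤ b
  negate = solve-∀

summand≡w₂ : ∀ x y π → summand (x ∷ y ∷ π) ≡ w₂ (x ∷ y ∷ π)
summand≡w₂ x y π = trans (cong negOnePow (ℤₚ.m-n≡m⊖n (suc (suc (length π))) y)) (negOnePow-⊖ (suc (suc (length π))) y)

twoParts? : ∀ π → _
twoParts? π = 2 ≤? length {A = ℕ} π

sumℤ-filter : ∀ πs → sumℤ (map summand (filter twoParts? πs)) ≡ sumℤ (map w₂ πs)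
sumℤ-filter []                 = refl
sumℤ-filter ([] ∷ πs)          = trans (sumℤ-filter πs) (sym (ℤₚ.+-identityˡ _))
sumℤ-filter ((x ∷ []) ∷ πs)    = trans (sumℤ-filter πs) (sym (ℤₚ.+-identityˡ _))
sumℤ-filter ((x ∷ y ∷ π) ∷ πs) = cong₂ _+ℤ_ (summand≡w₂ x y π) (sumℤ-filter πs)

-- Duplicate-free lists with the same members are permutations of each other, so the given
-- enumeration `L` can be exchanged for the computed one.
D₂-sum : ∀ n (L : List (List ℕ)) → Unique L → (∀ π → (π ∈ L) ⇔ D₂ n π) → sumℤ (map summand L) ≡ W₂ n 0 n
D₂-sum n L unique ∈L⇔ = begin
  sumℤ (map summand L)                                     ≡⟨ sumℤ-↭ (Perm.map⁺ summand L↭) ⟩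
  sumℤ (map summand (filter twoParts? (partitions n 0 n))) ≡⟨ sumℤ-filter (partitions n 0 n) ⟩
  weightSeries w₂ n 0 n                                    ≡⟨ weightSeries-w₂ n 0 n ⟩
  W₂ n 0 n                                                 ∎
  where
  open ≡-Reasoning
  open Equivalence
  L↭ : L ↭ filter twoParts? (partitions n 0 n)
  L↭ = ∼bag⇒↭ (unique∧set⇒bag unique (Unique.filter⁺ twoParts? (partitions-unique n 0 n)) (λ {π} → mk⇔
    (λ π∈ → let d , 2≤ = ∈L⇔ π .to π∈ in ∈-filter⁺ twoParts? (∈-partitions⇔ n π .from d) 2≤)
    (λ π∈ → let π∈′ , 2≤ = ∈-filter⁻ twoParts? π∈ in ∈L⇔ π .from (∈-partitions⇔ n π .to π∈′ , 2≤))))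

θ-coefficient : ∀ n ℓ → 1 ≤ n → ℓ ^ 2 ≤ n → n < (ℓ + 1) ^ 2 → -ℤ partialSum (θ n) n ≡ negOnePowℕ (ℓ ∸ 1)
-- `ℓ = 0` would force `n < 1`, so the subtraction in `ℓ ∸ 1` is never truncated.
θ-coefficient n zero    1≤n lower upper = contradiction (ℕₚ.<-≤-trans upper 1≤n) (ℕₚ.<-irrefl refl)
θ-coefficient n (suc ℓ) 1≤n lower upper = begin
  -ℤ partialSum (θ n) n                            ≡⟨ cong (λ i → -ℤ partialSum (θ i) n) (ℕₚ.m∸n+n≡m (ℕₚ.≤-trans (ℕₚ.m≤m*n (suc ℓ) (suc ℓ)) lower′)) ⟨
  -ℤ partialSum (θ (n ∸ suc ℓ + suc ℓ)) n          ≡⟨ cong -ℤ_ (partialSum-θ (suc ℓ) (n ∸ suc ℓ) n lower′ upper′) ⟩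
  -ℤ negOnePowℕ (suc ℓ)                            ≡⟨ cong -ℤ_ (negOnePowℕ-suc ℓ) ⟩
  -ℤ (-ℤ negOnePowℕ ℓ)                             ≡⟨ ℤₚ.neg-involutive (negOnePowℕ ℓ) ⟩
  negOnePowℕ ℓ                                     ∎
  where
  open ≡-Reasoning
  square : ∀ m → m ^ 2 ≡ m * m
  square m = cong (m *_) (ℕₚ.*-identityʳ m)
  lower′ : suc ℓ * suc ℓ ≤ n
  lower′ = subst (_≤ n) (square (suc ℓ)) lower
  upper′ : n < suc (suc ℓ) * suc (suc ℓ)
  upper′ = subst (n <_) (trans (square (suc ℓ + 1)) (cong (λ m → m * m) (ℕₚ.+-comm (suc ℓ) 1))) upper

theorem3p7 : (n : ℕ) → 1 ≤ n → (ℓ : ℕ) → ℓ ^ 2 ≤ n → n < (ℓ + 1) ^ 2 →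
    (L : List (List ℕ)) → Unique L → (∀ π → (π ∈ L) ⇔ D₂ n π) →
    ((j : ℕ) → 1 ≤ j → IsPentagonalFor n j →
    sumℤ (map summand L) ≡ negOnePowℕ (ℓ ∸ 1) +ℤ negOnePowℕ j)
    × (¬ (∃[ j ] (1 ≤ j × IsPentagonalFor n j)) →
    sumℤ (map summand L) ≡ negOnePowℕ (ℓ ∸ 1))
theorem3p7 n 1≤n ℓ lower upper L unique ∈L⇔ =
  (λ j 1≤j p → trans total (trans (cong (_+ℤ negOnePowℕ (ℓ ∸ 1)) (euler-pentagonal n j 1≤n 1≤j (IsPentagonalFor⇒isPentagonal n j p)))
    (ℤₚ.+-comm (negOnePowℕ j) _))) ,
  (λ ¬p → trans total (trans (cong (_+ℤ negOnePowℕ (ℓ ∸ 1)) (euler-below n n 1≤n (λ j 1≤j _ p → ¬p (j , 1≤j , isPentagonal⇒IsPentagonalFor n j p))))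
    (ℤₚ.+-identityˡ _)))
  where
  total : sumℤ (map summand L) ≡ euler n n +ℤ negOnePowℕ (ℓ ∸ 1)
  total = trans (D₂-sum n L unique ∈L⇔)
    (trans (W₂-coefficient n) (cong (euler n n +ℤ_) (θ-coefficient n ℓ 1≤n lower upper)))
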